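{- There is a family of unsatisfiable CNF formulas $\{F_n\}_{n=1}^{\infty}$ of size $\Theta(n)$ such that: (1) the minimal variable space of refuting $F_n$ in resolution is $\mathit{VarSp}(F_n\vdash 0)=\Theta(n)$; (2) any resolution refutation $\pi$ of $F_n$ in minimal variable space (i.e. with $\mathit{VarSp}(\pi)=\mathit{VarSp}(F_n\vdash 0)$) has length $\exp(\Omega(\sqrt{n}))$; (3) adding at most $2$ extra units of storage, it is possible to obtain a resolution refutation $\pi'$ of $F_n$ in variable space $\mathit{VarSp}(\pi')\le \mathit{VarSp}(F_n\vdash 0)+2=\Theta(n)$ and (simultaneously) length $L(\pi')=O(n)$, i.e. linear in the formula size.
   Context: A literal is a propositional variable $x$ or its negation $\overline{x}$. A clause is a finite set (disjunction) of literals over pairwise distinct variables; $0$ denotes the empty clause; the width $W(C)$ of a clause $C$ is its number of literals. A CNF formula is a finite set of clauses (of arbitrary widths). The size of a CNF formula is the total number of literals in it, counted with repetitions. The resolution rule derives $B\vee C$ from $B\vee x$ and $C\vee\overline{x}$. A resolution derivation from a CNF formula $F$ is a sequence $\{\mathbb{C}_0,\dots,\mathbb{C}_\tau\}$ of sets of clauses with $\mathbb{C}_0=\emptyset$ such that each $\mathbb{C}_t$ is obtained from $\mathbb{C}_{t-1}$ by one of: axiom download (adding some $C\in F$), erasure (removing some clause of $\mathbb{C}_{t-1}$), inference (adding a clause derived by the resolution rule from two clauses in $\mathbb{C}_{t-1}$). A refutation of $F$ is a derivation with $\mathbb{C}_\tau=\{0\}$. The length $L(\pi)$ of a derivation $\pi$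 is the number of distinct clauses in it. The variable space of a set of clauses is $\mathit{VarSp}(\mathbb{C})=\sum_{C\in\mathbb{C}}W(C)$, the variable space of a derivation is $\mathit{VarSp}(\pi)=\max_t \mathit{VarSp}(\mathbb{C}_t)$, and $\mathit{VarSp}(F\vdash 0)$ is the minimum variable space over all refutations of $F$. -}

module Defs where

open import Data.Bool.Base using (Bool; true; false)
open import Data.Bool.Properties as Bool using ()
open import Data.Fin.Base using (Fin)
open import Data.List.Base using (List; []; _∷_; [_]; concat; deduplicate; foldr; length; map; sum)
open import Data.List.Membership.Propositional using (_∈_; _∉_)
open import Data.List.Relation.Binary.BagAndSetEquality using (_∼[_]_; set)
open import Data.Maybe.Base using (Maybe; just; nothing)
open import Data.Maybe.Properties as Maybe using ()
open import Data.Nat.Base using (ℕ; suc; _+_; _*_; _^_; _⊔_; _≤_; _≥_)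
open import Data.Product.Base using (_×_; _,_; ∃; ∃-syntax)
open import Data.Sum.Base using (_⊎_)
open import Data.Vec.Base as Vec using (Vec; lookup; replicate)
open import Data.Vec.Properties as Vec using ()
open import Function.Bundles using (_⇔_)
open import Relation.Binary.Construct.Closure.ReflexiveTransitive using (Star; ε; _◅_)
open import Relation.Binary.Definitions using (DecidableEquality)
open import Relation.Binary.PropositionalEquality using (_≡_; _≢_)
open import Relation.Nullary using (¬_)

private
  variable
    N : ℕ

-- (x , true) is the literal x and (x , false) is its negation.
Literal : ℕ → Set
Literal N = Fin N × Bool

-- A set of literals over pairwise distinct variables: the entry at x is
-- just b if (x , b) is in the clause, and nothing if x does not occur in it.
-- This representation is canonical, so _≡_ on clauses is equality of sets.
Clause : ℕ → Set
Clause N = Vec (Maybe Bool) N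

infix 4 _∈ₗ_

_∈ₗ_ : Literal N → Clause N → Set
(x , b) ∈ₗ C = lookup C x ≡ just b

𝟘 : Clause N
𝟘 = replicate _ nothing

width : Clause N → ℕ
width Vec.[]               = 0
width (just _  Vec.∷ C) = suc (width C)
width (nothing Vec.∷ C) = width C

_≟ᶜ_ : DecidableEquality (Clause N)
_≟ᶜ_ = Vec.≡-dec (Maybe.≡-dec Bool._≟_)

-- Finite sets of clauses are lists considered up to _∼[ set ]_; order and
-- multiplicity of entries are irrelevant, so every quantity attached to such
-- a set is computed after removing duplicates.
ClauseSet : ℕ → Set
ClauseSet N = List (Clause N)

distinct : ClauseSet N → ClauseSet N
distinct = deduplicate _≟ᶜ_

totalWidth : ClauseSet N → ℕ
totalWidth ℂ = sum (map width (distinct ℂ))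

-- The variables of a formula are taken from Fin numVars. Resolution never
-- introduces new variables, so refutations need no others.
record CNF : Set where
  field
    numVars : ℕ
    clauses : ClauseSet numVars

open CNF public

size : CNF → ℕ
size F = totalWidth (clauses F)

Assignment : ℕ → Set
Assignment N = Fin N → Bool

_⊨_ : Assignment N → Clause N → Set
α ⊨ C = ∃[ x ] (x , α x) ∈ₗ C

Unsatisfiable : CNF → Set
Unsatisfiable F = (α : Assignment (numVars F)) → ¬ (∀ {C} → C ∈ clauses F → α ⊨ C)

-- P = B ∨ x and Q = C ∨ x̄ yield R = B ∨ C, where B and C do not mention x.
-- As R is a clause, B ∨ C is required not to contain complementary literals.
record Resolvent (P Q R : Clause N) : Set where
  field
    pivot    : Fin N
    positive : (pivot , true) ∈ₗ P
    negative : (pivot , false) ∈ₗ Q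
    union    : ∀ y b → (y , b) ∈ₗ R ⇔ (y ≢ pivot × ((y , b) ∈ₗ P ⊎ (y , b) ∈ₗ Q))

data Step (F : CNF) (ℂ ℂ′ : ClauseSet (numVars F)) : Set where
  download  : ∀ {C} → C ∈ clauses F → ℂ′ ∼[ set ] (C ∷ ℂ) → Step F ℂ ℂ′
  erasure   : ∀ {C} → C ∉ ℂ′ → ℂ ∼[ set ] (C ∷ ℂ′) → Step F ℂ ℂ′
  inference : ∀ {P Q R} → P ∈ ℂ → Q ∈ ℂ → Resolvent P Q R →
              ℂ′ ∼[ set ] (R ∷ ℂ) → Step F ℂ ℂ′

Refutation : CNF → Set
Refutation F = Star (Step F) [] [ 𝟘 ]

-- The sequence ℂ₀ , … , ℂ_τ, both endpoints included.
configurations : ∀ {F ℂ 𝔻} → Star (Step F) ℂ 𝔻 → List (ClauseSet (numVars F))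
configurations {ℂ = ℂ} ε       = [ ℂ ]
configurations {ℂ = ℂ} (_ ◅ π) = ℂ ∷ configurations π

varSp : ∀ {F} → Refutation F → ℕ
varSp π = foldr _⊔_ 0 (map totalWidth (configurations π))

-- The number of distinct clauses, not the number of steps.
len : ∀ {F} → Refutation F → ℕ
len π = length (distinct (concat (configurations π)))

-- s = VarSp(F ⊢ 0)
IsMinVarSp : CNF → ℕ → Set
IsMinVarSp F s = (∃[ π ] varSp {F} π ≡ s) × (∀ (π : Refutation F) → s ≤ varSp π)

infix 4 _∈O_ _∈Ω_ _∈Θ_

_∈O_ _∈Ω_ _∈Θ_ : (ℕ → ℕ) → (ℕ → ℕ) → Set
f ∈O g = ∃[ c ] ∃[ n₀ ] (∀ n → n ≥ n₀ → f n ≤ c * g n)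
f ∈Ω g = g ∈O f
f ∈Θ g = f ∈O g × f ∈Ω g

-- For c ≥ 1 this is the real inequality 2^(√n / c) ≤ L, that is
-- 2^√n ≤ L^c, with √n given by the rationals p / q below it. (If c = 0 it
-- fails for every n ≥ 1.) Base 2 instead of e only rescales the constant c
-- in exp(Ω(√n)).
2^[√_/_]≤_ : ℕ → ℕ → ℕ → Set
2^[√ n / c ]≤ L = ∀ p q → p * p ≤ n * (q * q) → 2 ^ p ≤ L ^ (c * q)

{-# OPTIONS --safe #-}
-- The formula is a conjunction of two formulas on disjoint variables. One is
-- the clause z₀ ∨ … ∨ z_{K+1} with all units ¬zᵢ. The other is the clause
-- y₀ ∨ … ∨ y_K with the units ¬yᵢ for i ≥ 1 only, where ¬y₀ is replaced by a
-- hard unsatisfiable formula each of whose clauses is weakened by ¬y₀.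
--
-- Resolving a positive clause of width k leaves a resolvent of width at least
-- k − 1 next to it and a second premise, which takes space 2k. So some refutation
-- needs no more than space 2(K+1), once K is large enough for the hard formula
-- to be refuted in that space, and none needs less; and at that space the
-- z-clause is useless, whereas with 2 more units it gives a linear refutation.
--
-- The hard formula is the Tseitin formula of an m × m grid with doubled edges,
-- where m is about √n. A decision tree that halves the longer side of a
-- rectangle of odd charge has depth O(m), which gives a refutation in space
-- O(m²). For the length, fix at random, on each line of the grid, one of the two
-- copies of all edges to a constant. A clause touching m − 1 lines survives with
-- probability at most (3/4)^{m−1}, so that in a shorter refutation some choice
-- satisfies all such clauses. The remaining clauses leave a row and a column
-- untouched; assignments whose only violated cell is where these cross satisfy
-- the clause, an invariant preserved by resolution since the violated cell can
-- be moved along an untouched line.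
module Submission where

open import Defs
open import Data.Bool.Base using (Bool; T; true; false; not; _xor_; _∧_; if_then_else_)
open import Data.Bool.Properties as Boolₚ using ()
open import Data.Bool.Solver using (module xor-∧-Solver)
open import Data.Empty using (⊥-elim)
open import Data.Fin.Base as Fin using (Fin; zero; suc; toℕ; fromℕ<)
open import Data.Fin.Properties as Finₚ using ()
open import Data.List.Base using (List; []; _∷_; [_]; _++_; allFin; cartesianProduct; concat; filter; foldr; length;
                                 map; tabulate; upTo)
open import Data.List.Properties as Listₚ using (length-map)
open import Data.List.Membership.Propositional using (_∈_; _∉_)
open import Data.List.Membership.Propositional.Properties
open import Data.List.Membership.DecPropositional using () renaming (_∈?_ to mem?)
open import Data.List.Relation.Binary.BagAndSetEquality using (_∼[_]_; set)
open import Data.List.Relation.Binary.Permutation.Propositional using (↭-sym)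
open import Data.List.Relation.Binary.Permutation.Propositional.Properties as ↭ using (shift)
open import Data.List.Relation.Binary.Subset.Propositional using (_⊆_)
open import Data.List.Relation.Unary.All as All using (All; []; _∷_)
open import Data.List.Relation.Unary.Any using (here; there)
open import Data.List.Relation.Unary.Unique.Propositional using (Unique; []; _∷_)
open import Data.List.Relation.Unary.Unique.Propositional.Properties as Unique using ()
open import Data.List.Relation.Unary.Unique.DecPropositional.Properties using (deduplicate-!)
open import Data.Maybe.Base as Maybe using (Maybe; just; nothing; _<∣>_)
open import Data.Maybe.Properties as Maybeₚ using (just-injective)
open import Data.Nat.Base hiding (parity)
open import Data.Nat.ListAction using (sum)
open import Data.Nat.ListAction.Properties as ListAction using (sum-↭)
open import Data.Nat.Properties
open import Data.Nat.Solver using (module +-*-Solver)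
open import Data.Product.Base using (_×_; _,_; proj₁; proj₂; ∃-syntax; Σ-syntax)
open import Data.Product.Properties using (≡-dec)
open import Data.Product.Function.NonDependent.Propositional using (_×-↔_)
open import Data.Sum.Function.Propositional using (_⊎-↔_)
open import Data.Sum.Properties using (inj₁-injective; inj₂-injective)
open import Data.Sum.Base using (_⊎_; inj₁; inj₂; [_,_]′)
open import Data.Unit.Base using (⊤; tt)
open import Data.Vec.Base as Vec using (Vec; []; _∷_; lookup)
open import Data.Vec.Properties using (lookup∘tabulate; lookup-replicate)
open import Function.Base using (_∘_; id; const; case_of_)
open import Function.Bundles using (Equivalence; Inverse; _↔_; mk⇔)
open import Function.Construct.Composition using (_↔-∘_)
open import Relation.Binary.Construct.Closure.ReflexiveTransitive using (Star; ε; _◅_; _◅◅_)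
open import Relation.Binary.PropositionalEquality hiding ([_])
open import Relation.Nullary using (¬_; Dec; yes; no; does; contradiction)

open Equivalence using (to; from)

-- Sums over lists, supports and widths of clauses.

private
  variable
    A : Set
    N : ℕ

-- Induction on `xs`: one occurrence of the head is cut out of `ys`, and uniqueness keeps the rest
-- of `xs` inside what remains. The comparisons of `width`, `totalWidth` and `len` all rest on this.
sum-⊆ : (f : A → ℕ) {xs ys : List A} → Unique xs → xs ⊆ ys → sum (map f xs) ≤ sum (map f ys)
sum-⊆ f [] _ = z≤n
sum-⊆ f {x ∷ xs} (x∉xs ∷ u) sub with ∈-∃++ (sub (here refl))
... | ys , zs , refl = begin
  f x + sum (map f xs)          ≤⟨ +-monoʳ-≤ (f x) (sum-⊆ f u sub′) ⟩
  f x + sum (map f (ys ++ zs))  ≡⟨ sum-↭ (↭.map⁺ f (↭-sym (shift x ys zs))) ⟩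
  sum (map f (ys ++ x ∷ zs))    ∎
  where
  open ≤-Reasoning
  sub′ : xs ⊆ ys ++ zs
  sub′ p with ∈-++⁻ ys (sub (there p))
  ... | inj₁ q           = ∈-++⁺ˡ q
  ... | inj₂ (here refl) = contradiction refl (All.lookup x∉xs p)
  ... | inj₂ (there q)   = ∈-++⁺ʳ ys q

sum-const : (k : ℕ) (xs : List A) → sum (map (const k) xs) ≡ length xs * k
sum-const k []       = refl
sum-const k (x ∷ xs) = cong (k +_) (sum-const k xs)

sum-≤ : (f : A → ℕ) (k : ℕ) (xs : List A) → (∀ {x} → x ∈ xs → f x ≤ k) → sum (map f xs) ≤ length xs * k
sum-≤ f k []       _ = z≤n
sum-≤ f k (x ∷ xs) h = +-mono-≤ (h (here refl)) (sum-≤ f k xs (h ∘ there))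

length-⊆ : {xs ys : List A} → Unique xs → xs ⊆ ys → length xs ≤ length ys
length-⊆ {xs = xs} {ys} u sub = subst₂ _≤_ (one xs) (one ys) (sum-⊆ (const 1) u sub)
  where
  one : ∀ zs → sum (map (const 1) zs) ≡ length zs
  one zs = trans (sum-const 1 zs) (*-identityʳ _)

-- Polymorphic in the entries, as it serves both clauses and the profiles over grid lines in the
-- lower bound.
support : Vec (Maybe A) N → List (Fin N)
support []            = []
support (just _ ∷ v)  = zero ∷ map suc (support v)
support (nothing ∷ v) = map suc (support v)

∈-support⁺ : (v : Vec (Maybe A) N) {i : Fin N} {a : A} → lookup v i ≡ just a → i ∈ support v
∈-support⁺ (just _ ∷ v)  {zero}  _ = here refl
∈-support⁺ (just _ ∷ v)  {suc i} e = there (∈-map⁺ suc (∈-support⁺ v e))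
∈-support⁺ (nothing ∷ v) {suc i} e = ∈-map⁺ suc (∈-support⁺ v e)

∈-support⁻ : (v : Vec (Maybe A) N) {i : Fin N} → i ∈ support v → ∃[ a ] lookup v i ≡ just a
∈-support⁻ (just a ∷ v) (here refl) = a , refl
∈-support⁻ (just a ∷ v) (there p) with ∈-map⁻ suc p
... | _ , q , refl = ∈-support⁻ v q
∈-support⁻ (nothing ∷ v) p with ∈-map⁻ suc p
... | _ , q , refl = ∈-support⁻ v q

support-unique : (v : Vec (Maybe A) N) → Unique (support v)
support-unique []            = []
support-unique (just _ ∷ v)  =
  All.tabulate (λ p e → case ∈-map⁻ suc p of λ { (_ , _ , q) → Finₚ.0≢1+n (trans e q) })
  ∷ Unique.map⁺ Finₚ.suc-injective (support-unique v)
support-unique (nothing ∷ v) = Unique.map⁺ Finₚ.suc-injective (support-unique v)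

length-support : (C : Clause N) → length (support C) ≡ width C
length-support []            = refl
length-support (just _ ∷ C)  = cong suc (trans (length-map suc (support C)) (length-support C))
length-support (nothing ∷ C) = trans (length-map suc (support C)) (length-support C)

infix 4 _⊆ₗ_

_⊆ₗ_ : Clause N → Clause N → Set
C ⊆ₗ D = ∀ {y b} → (y , b) ∈ₗ C → (y , b) ∈ₗ D

width-≤ : (C : Clause N) (xs : List (Fin N)) → (∀ {y b} → (y , b) ∈ₗ C → y ∈ xs) → width C ≤ length xs
width-≤ C xs h = subst (_≤ length xs) (length-support C)
  (length-⊆ (support-unique C) (λ p → h (proj₂ (∈-support⁻ C p))))

≤-width : (C : Clause N) {xs : List (Fin N)} → Unique xs → (∀ {y} → y ∈ xs → ∃[ b ] (y , b) ∈ₗ C) →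
          length xs ≤ width C
≤-width C {xs} u h = subst (length xs ≤_) (length-support C)
  (length-⊆ u (λ p → ∈-support⁺ C (proj₂ (h p))))

width-mono : (C D : Clause N) → C ⊆ₗ D → width C ≤ width D
width-mono C D sub = subst (width C ≤_) (length-support D)
  (width-≤ C (support D) (λ e → ∈-support⁺ D (sub e)))

lookup-ext : (u v : Vec A N) → (∀ i → lookup u i ≡ lookup v i) → u ≡ v
lookup-ext []      []      _ = refl
lookup-ext (x ∷ u) (y ∷ v) h = cong₂ _∷_ (h zero) (lookup-ext u v (h ∘ suc))

literal-ext : {C D : Clause N} → C ⊆ₗ D → D ⊆ₗ C → C ≡ D
literal-ext {C = C} {D} C⊆D D⊆C = lookup-ext C D eq
  where
  eq : ∀ i → lookup C i ≡ lookup D i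
  eq i with lookup C i in p | lookup D i in q
  ... | just b  | d       = trans (sym (C⊆D p)) q
  ... | nothing | just b  = trans (sym p) (D⊆C q)
  ... | nothing | nothing = refl

∉-𝟘 : ∀ {y b} → ¬ ((y , b) ∈ₗ 𝟘 {N})
∉-𝟘 {y = y} e with trans (sym (lookup-replicate y nothing)) e
... | ()

-- Total width, restricted derivations and invariants.

distinct-unique : (ℂ : ClauseSet N) → Unique (distinct ℂ)
distinct-unique = deduplicate-! _≟ᶜ_

sum-≤-totalWidth : {Cs ℂ : ClauseSet N} → Unique Cs → Cs ⊆ ℂ → sum (map width Cs) ≤ totalWidth ℂ
sum-≤-totalWidth u sub = sum-⊆ width u (∈-deduplicate⁺ _≟ᶜ_ ∘ sub)

totalWidth-≤-sum : (ℂ : ClauseSet N) → totalWidth ℂ ≤ sum (map width ℂ)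
totalWidth-≤-sum ℂ = sum-⊆ width (distinct-unique ℂ) (∈-deduplicate⁻ _≟ᶜ_ ℂ)

totalWidth-mono : {𝔹 𝔸 : ClauseSet N} → 𝔹 ⊆ 𝔸 → totalWidth 𝔹 ≤ totalWidth 𝔸
totalWidth-mono {𝔹 = 𝔹} sub = sum-≤-totalWidth (distinct-unique 𝔹) (sub ∘ ∈-deduplicate⁻ _≟ᶜ_ 𝔹)

-- `Q` will be a space bound, for the short refutation together with containment in a fixed list of
-- clauses. Closure under subsets lets `Q` pass to any list with the same elements and to what an
-- erasure leaves.
module Bounded (F : CNF) (Q : ClauseSet (numVars F) → Set)
               (Q-mono : ∀ {𝔸 𝔹} → 𝔹 ⊆ 𝔸 → Q 𝔸 → Q 𝔹) where

  private
    variable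
      ℂ 𝔻 𝔼 : ClauseSet (numVars F)

  QStep : ClauseSet (numVars F) → ClauseSet (numVars F) → Set
  QStep ℂ ℂ′ = Step F ℂ ℂ′ × Q ℂ′

  -- Configurations are sets, but a path of steps ends in one particular list;
  -- quantifying over all lists with the same elements makes reachability
  -- independent of the representation, also where no step would be needed.
  Reaches : ClauseSet (numVars F) → ClauseSet (numVars F) → Set
  Reaches ℂ 𝔻 = ∀ {𝔹} → 𝔹 ∼[ set ] 𝔻 → Star QStep ℂ 𝔹

  here! : Reaches ℂ 𝔻 → Star QStep ℂ 𝔻
  here! r = r (mk⇔ id id)

  infixr 5 _▻_
  _▻_ : Reaches ℂ 𝔻 → Reaches 𝔻 𝔼 → Reaches ℂ 𝔼
  (r ▻ r′) e = here! r ◅◅ r′ e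

  downloads : ∀ {C} → C ∈ clauses F → Q (C ∷ ℂ) → Reaches ℂ (C ∷ ℂ)
  downloads C∈F q e = (download C∈F e , Q-mono (λ p → e .to p) q) ◅ ε

  infers : ∀ {P P′ R} → P ∈ ℂ → P′ ∈ ℂ → Resolvent P P′ R → Q (R ∷ ℂ) → Reaches ℂ (R ∷ ℂ)
  infers p p′ r q e = (inference p p′ r e , Q-mono (λ p → e .to p) q) ◅ ε

  erase : ∀ {C} → Q (C ∷ 𝔻) → Reaches ℂ (C ∷ 𝔻) → Reaches ℂ 𝔻
  erase {C = C} q r {𝔹} e with mem? _≟ᶜ_ C 𝔹
  -- Here `C` also belongs to `𝔻`, so `C ∷ 𝔻` and `𝔻` are the same set and no erasure is made.
  ... | yes C∈𝔹 = r (mk⇔ (λ p → there (e .to p)) λ { (here refl) → C∈𝔹 ; (there p) → e .from p })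
  ... | no  C∉𝔹 =
    r (mk⇔ (λ { (here refl) → here refl ; (there p) → there (e .to p) })
           (λ { (here refl) → here refl ; (there p) → there (e .from p) }))
    ◅◅ (erasure C∉𝔹 (mk⇔ id id) , Q-mono (λ p → there (e .to p)) q) ◅ ε

  rearrange : 𝔼 ∼[ set ] 𝔻 → Reaches ℂ 𝔻 → Reaches ℂ 𝔼
  rearrange 𝔼∼𝔻 r e = r (mk⇔ (λ p → 𝔼∼𝔻 .to (e .to p)) (λ p → e .from (𝔼∼𝔻 .from p)))

  steps : Q ℂ → Star QStep ℂ 𝔻 → Σ[ π ∈ Star (Step F) ℂ 𝔻 ] All Q (configurations π)
  steps q ε              = ε , q ∷ []
  steps q ((s , q′) ◅ σ) = let π , qs = steps q′ σ in s ◅ π , q ∷ qs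

-- The invariant of a derivation may use that R and its premises lie together
-- in one configuration, of which Good holds.
invariant : {F : CNF} {ℂ 𝔻 : ClauseSet (numVars F)} (Good : ClauseSet (numVars F) → Set)
            (I : Clause (numVars F) → Set) → (∀ {C} → C ∈ clauses F → I C) →
            (∀ {ℂ P P′ R} → Good ℂ → P ∈ ℂ → P′ ∈ ℂ → R ∈ ℂ → Resolvent P P′ R → I P → I P′ → I R) →
            (π : Star (Step F) ℂ 𝔻) → All Good (configurations π) →
            (∀ {C} → C ∈ ℂ → I C) → ∀ {C} → C ∈ 𝔻 → I C
invariant Good I ax inf ε _ h = h
invariant {F} {ℂ} Good I ax inf (_◅_ {j = 𝔹} s π) (_ ∷ gs) h = invariant Good I ax inf π gs (next s)
  where
  first : ∀ {ℂ 𝔻} (π : Star (Step F) ℂ 𝔻) → All Good (configurations π) → Good ℂ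
  first ε       (g ∷ _) = g
  first (_ ◅ _) (g ∷ _) = g

  next : Step F ℂ 𝔹 → ∀ {C} → C ∈ 𝔹 → I C
  next (download C∈F e) p with e .to p
  ... | here refl = ax C∈F
  ... | there q   = h q
  next (erasure _ e) p = h (e .from (there p))
  next (inference P∈ P′∈ r e) p with e .to p
  ... | here refl = inf (first π gs) (e .from (there P∈)) (e .from (there P′∈)) p r (h P∈) (h P′∈)
  ... | there q   = h q

module _ {P P′ R : Clause N} (r : Resolvent P P′ R) where
  open Resolvent r

  -- The pivot cannot witness the truth of both premises, as it would need both values; any other
  -- witness survives in `R`.
  resolvent-sound : {α : Assignment N} → α ⊨ P → α ⊨ P′ → α ⊨ R
  resolvent-sound {α} (x , p) (x′ , p′) with x Finₚ.≟ pivot | x′ Finₚ.≟ pivot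
  ... | no x≢  | _       = x , union x (α x) .from (x≢ , inj₁ p)
  ... | yes _  | no x′≢  = x′ , union x′ (α x′) .from (x′≢ , inj₂ p′)
  ... | yes refl | yes refl = contradiction
    (just-injective (trans (sym positive) (trans p (trans (sym p′) negative)))) λ ()

𝟘-unsatisfied : {α : Assignment N} → ¬ (α ⊨ 𝟘)
𝟘-unsatisfied (y , e) = ∉-𝟘 {y = y} e

refutation-unsat : {F : CNF} → Refutation F → Unsatisfiable F
refutation-unsat {F} π α sat = 𝟘-unsatisfied
  (invariant (λ _ → ⊤) (α ⊨_) sat (λ _ _ _ _ r → resolvent-sound r) π (All.universal (λ _ → tt) _) (λ ()) (here refl))

-- Clauses that exclude a partial assignment.

infix 4 _∈?_
_∈?_ : (x : Fin N) (S : List (Fin N)) → Dec (x ∈ S)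
_∈?_ = mem? Finₚ._≟_

-- The clause on the variables S that is false exactly under the assignments agreeing with β on S.
blocking : Assignment N → List (Fin N) → Clause N
blocking β S = Vec.tabulate λ x → if does (x ∈? S) then just (not (β x)) else nothing

module _ {β : Assignment N} {S : List (Fin N)} where

  ∈-blocking⁺ : ∀ {x} → x ∈ S → (x , not (β x)) ∈ₗ blocking β S
  ∈-blocking⁺ {x} x∈S = trans (lookup∘tabulate _ x) eq
    where
    eq : (if does (x ∈? S) then just (not (β x)) else nothing) ≡ just (not (β x))
    eq with x ∈? S
    ... | yes _  = refl
    ... | no x∉S = contradiction x∈S x∉S

  ∈-blocking⁻ : ∀ {x b} → (x , b) ∈ₗ blocking β S → x ∈ S × b ≡ not (β x)
  ∈-blocking⁻ {x} {b} e = eq (trans (sym (lookup∘tabulate _ x)) e)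
    where
    eq : (if does (x ∈? S) then just (not (β x)) else nothing) ≡ just b → x ∈ S × b ≡ not (β x)
    eq e with x ∈? S
    eq refl | yes x∈S = x∈S , refl

  width-blocking-≤ : width (blocking β S) ≤ length S
  width-blocking-≤ = width-≤ (blocking β S) S (proj₁ ∘ ∈-blocking⁻)

  width-blocking : Unique S → width (blocking β S) ≡ length S
  width-blocking u = ≤-antisym width-blocking-≤ (≤-width (blocking β S) u λ x∈S → _ , ∈-blocking⁺ x∈S)

blocking-mono : {β γ : Assignment N} {S T : List (Fin N)} → S ⊆ T → (∀ {x} → x ∈ S → β x ≡ γ x) →
                blocking β S ⊆ₗ blocking γ T
blocking-mono {β = β} {γ} {S} {T} S⊆T agree {y} e with ∈-blocking⁻ {β = β} {S} e
... | y∈S , refl = subst (λ b → lookup (blocking γ T) y ≡ just (not b)) (sym (agree y∈S))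
                         (∈-blocking⁺ {β = γ} {T} (S⊆T y∈S))

blocking-[] : (β : Assignment N) → blocking β [] ≡ 𝟘
blocking-[] β = literal-ext (λ e → case proj₁ (∈-blocking⁻ {β = β} {[]} e) of λ ())
                                  (λ {y} e → contradiction e (∉-𝟘 {y = y}))

-- Positive clauses: their linear refutation, and the space of an inference from them.

posClause : List (Fin N) → Clause N
posClause = blocking (const false)

-- As `blocking` negates the assignment, `const true` yields the negative literal here and
-- `const false` the positive ones of `posClause`.
negUnit : Fin N → Clause N
negUnit x = blocking (const true) [ x ]

width-negUnit : (x : Fin N) → width (negUnit x) ≤ 1
width-negUnit x = width-blocking-≤ {β = const true} {[ x ]}

posClause-resolvent : {x : Fin N} {xs : List (Fin N)} → Unique (x ∷ xs) →
                      Resolvent (posClause (x ∷ xs)) (negUnit x) (posClause xs)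
posClause-resolvent {x = x} {xs} (x∉xs ∷ _) = record
  { pivot    = x
  ; positive = ∈-blocking⁺ {β = const false} {x ∷ xs} (here refl)
  ; negative = ∈-blocking⁺ {β = const true} {[ x ]} (here refl)
  ; union    = λ y b → mk⇔
      (λ e → let y∈xs , b≡ = ∈-blocking⁻ {β = const false} {xs} e in
             (λ { refl → All.lookup x∉xs y∈xs refl }) ,
             inj₁ (subst (λ b → (y , b) ∈ₗ posClause (x ∷ xs)) (sym b≡)
                         (∈-blocking⁺ {β = const false} {x ∷ xs} (there y∈xs))))
      λ { (y≢x , inj₁ e) → old y≢x (∈-blocking⁻ {β = const false} {x ∷ xs} e)
        ; (y≢x , inj₂ e) → case proj₁ (∈-blocking⁻ {β = const true} {[ x ]} e) of
            λ { (here y≡x) → contradiction y≡x y≢x } }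
  }
  where
  old : ∀ {y b} → y ≢ x → y ∈ x ∷ xs × b ≡ true → (y , b) ∈ₗ posClause xs
  old y≢x (here y≡x , _)     = contradiction y≡x y≢x
  old y≢x (there y∈xs , refl) = ∈-blocking⁺ {β = const false} {xs} y∈xs

totalWidth-∷ : (C : Clause N) (ℂ : ClauseSet N) → totalWidth (C ∷ ℂ) ≤ width C + totalWidth ℂ
totalWidth-∷ C ℂ = sum-⊆ width (distinct-unique (C ∷ ℂ)) sub
  where
  sub : distinct (C ∷ ℂ) ⊆ C ∷ distinct ℂ
  sub p with ∈-deduplicate⁻ _≟ᶜ_ (C ∷ ℂ) p
  ... | here e  = here e
  ... | there q = there (∈-deduplicate⁺ _≟ᶜ_ q)

-- The clauses that `cascade` may use, listed in order to bound the length of the refutation.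
cascadeClauses : List (Fin N) → ClauseSet N
cascadeClauses []       = [ 𝟘 ]
cascadeClauses (x ∷ xs) = posClause (x ∷ xs) ∷ negUnit x ∷ cascadeClauses xs

length-cascadeClauses : (xs : List (Fin N)) → length (cascadeClauses xs) ≡ suc (2 * length xs)
length-cascadeClauses []       = refl
length-cascadeClauses (x ∷ xs) = cong suc (trans (cong suc (length-cascadeClauses xs))
                                                 (sym (*-suc 2 (length xs))))

posClause-∈-cascadeClauses : (xs : List (Fin N)) → posClause xs ∈ cascadeClauses xs
posClause-∈-cascadeClauses []       = here (blocking-[] (const false))
posClause-∈-cascadeClauses (x ∷ xs) = here refl

module _ {F : CNF} (Q : ClauseSet (numVars F) → Set) (Q-mono : ∀ {𝔸 𝔹} → 𝔹 ⊆ 𝔸 → Q 𝔸 → Q 𝔹) where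
  open Bounded F Q Q-mono

  -- One literal is resolved away at a time, and both premises are erased at once. With `k` literals
  -- left the peak is premise, unit and resolvent: k + 1 + (k - 1) = 2k. The first unit is part of
  -- the starting configuration because for `y₀` it is derived and not an axiom.
  cascade : ∀ x xs → Unique (x ∷ xs) → (∀ {y} → y ∈ xs → negUnit y ∈ clauses F) →
            (∀ {ℂ} → totalWidth ℂ ≤ 2 * length (x ∷ xs) → ℂ ⊆ cascadeClauses (x ∷ xs) → Q ℂ) →
            Reaches (posClause (x ∷ xs) ∷ negUnit x ∷ []) [ 𝟘 ]
  cascade x xs u@(_ ∷ uxs) units hQ =
    finish xs uxs units (λ tw sub → hQ (≤-trans tw (*-monoʳ-≤ 2 (n≤1+n _))) (there ∘ there ∘ sub))
      (erase (small there) (erase (small id) (rearrange swap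
        (infers (here refl) (there (here refl)) (posClause-resolvent u) start))))
    where
    W R : Clause (numVars F)
    W = posClause (x ∷ xs)
    R = posClause xs

    all : ClauseSet (numVars F)
    all = R ∷ W ∷ negUnit x ∷ []

    swap : (W ∷ negUnit x ∷ R ∷ []) ∼[ set ] all
    swap = mk⇔ (λ { (here p) → there (here p) ; (there (here p)) → there (there (here p))
                  ; (there (there (here p))) → here p })
               (λ { (here p) → there (there (here p)) ; (there (here p)) → here p
                  ; (there (there (here p))) → there (here p) })

    start : Q all
    start = hQ tw λ { (here refl) → there (there (posClause-∈-cascadeClauses xs))
                    ; (there (here p)) → here p ; (there (there (here p))) → there (here p) }
      where
      open ≤-Reasoning
      n = length xs
      tw : totalWidth all ≤ 2 * suc n
      tw = begin
        totalWidth all                              ≤⟨ totalWidth-≤-sum all ⟩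
        width R + (width W + (width (negUnit x) + 0))
          ≤⟨ +-mono-≤ (width-blocking-≤ {β = const false} {xs})
               (+-mono-≤ (width-blocking-≤ {β = const false} {x ∷ xs}) (+-monoˡ-≤ 0 (width-negUnit x))) ⟩
        n + (suc n + 1)                             ≡⟨ cong (n +_) (+-comm (suc n) 1) ⟩
        n + suc (suc n)                             ≡⟨ +-suc n (suc n) ⟩
        suc n + suc n                               ≡⟨ cong (suc n +_) (+-identityʳ (suc n)) ⟨
        2 * suc n                                   ∎

    small : ∀ {ℂ} → ℂ ⊆ W ∷ negUnit x ∷ R ∷ [] → Q ℂ
    small sub = Q-mono (λ p → swap .to (sub p)) start

    finish : ∀ {ℂ} xs → Unique xs → (∀ {y} → y ∈ xs → negUnit y ∈ clauses F) →
             (∀ {ℂ} → totalWidth ℂ ≤ 2 * length xs → ℂ ⊆ cascadeClauses xs → Q ℂ) →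
             Reaches ℂ [ posClause xs ] → Reaches ℂ [ 𝟘 ]
    finish     []       _ _     _  r = subst (Reaches _ ∘ [_]) (blocking-[] (const false)) r
    finish {ℂ} (y ∷ ys) u units hQ r =
      r ▻ rearrange swap₂ (downloads (units (here refl)) q) ▻ cascade y ys u (units ∘ there) hQ
      where
      swap₂ : (posClause (y ∷ ys) ∷ negUnit y ∷ []) ∼[ set ] (negUnit y ∷ posClause (y ∷ ys) ∷ [])
      swap₂ = mk⇔ (λ { (here p) → there (here p) ; (there (here p)) → here p })
                  (λ { (here p) → there (here p) ; (there (here p)) → here p })

      open ≤-Reasoning
      n = length ys
      q : Q (negUnit y ∷ posClause (y ∷ ys) ∷ [])
      q = hQ (begin
          totalWidth (negUnit y ∷ posClause (y ∷ ys) ∷ [])   ≤⟨ totalWidth-≤-sum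
              (negUnit y ∷ posClause (y ∷ ys) ∷ []) ⟩
          width (negUnit y) + (width (posClause (y ∷ ys)) + 0)
            ≤⟨ +-mono-≤ (width-negUnit y) (+-monoˡ-≤ 0 (width-blocking-≤ {β = const false} {y ∷ ys})) ⟩
          suc (suc n + 0)                                    ≤⟨ s≤s (m≤n+m (suc n + 0) n) ⟩
          2 * suc n                                          ∎)
        λ { (here p) → there (here p) ; (there (here p)) → here p }

-- If W is a positive clause, its resolvents contain all but one of its
-- literals, so that the inference needs almost twice its width.
wide-premise : {W P P′ R : Clause N} {ℂ : ClauseSet N} → (∀ {x} → ¬ (x , false) ∈ₗ W) →
               totalWidth ℂ < 2 * width W → P ∈ ℂ → P′ ∈ ℂ → R ∈ ℂ → Resolvent P P′ R →
               P ≢ W × P′ ≢ W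
wide-premise {W = W} {P} {P′} {R} {ℂ} pos small P∈ P′∈ R∈ r = P≢W , P′≢W
  where
  open Resolvent r
  P′≢W : P′ ≢ W
  P′≢W refl = pos negative

  P≢W : P ≢ W
  P≢W refl = <⇒≱ small (begin
    2 * width W                        ≡⟨ cong (width W +_) (+-identityʳ _) ⟩
    width W + width W                  ≤⟨ +-monoʳ-≤ (width W) W≤1+R ⟩
    width W + (1 + width R)            ≤⟨ +-monoʳ-≤ (width W) (+-mono-≤ 1≤P′ (m≤m+n _ 0)) ⟩
    width W + (width P′ + (width R + 0)) ≤⟨ sum-≤-totalWidth uniq
        (λ { (here refl) → P∈ ; (there (here refl)) → P′∈ ; (there (there (here refl))) → R∈ }) ⟩
    totalWidth ℂ                       ∎)
    where
    open ≤-Reasoning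
    no-pivot : ∀ {b} → ¬ (pivot , b) ∈ₗ R
    no-pivot e = proj₁ (union pivot _ .to e) refl

    -- `totalWidth` counts a clause once, so the three must differ: `W` has no negative literal and
    -- `R` does not mention the pivot.
    uniq : Unique (W ∷ P′ ∷ R ∷ [])
    uniq = ((P′≢W ∘ sym) ∷ (λ { refl → no-pivot positive }) ∷ []) ∷ ((λ { refl → no-pivot negative }) ∷ []) ∷ [] ∷ []

    1≤P′ : 1 ≤ width P′
    1≤P′ = ≤-width P′ ([] ∷ []) λ { (here refl) → false , negative }

    W≤1+R : width W ≤ 1 + width R
    W≤1+R = subst (width W ≤_) (cong suc (length-support R)) (width-≤ W (pivot ∷ support R) mem)
      where
      mem : ∀ {y b} → (y , b) ∈ₗ W → y ∈ pivot ∷ support R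
      mem {y} {b} e with y Finₚ.≟ pivot
      ... | yes y≡ = here y≡
      ... | no  y≢ = there (∈-support⁺ R (union y b .from (y≢ , inj₁ e)))

-- Space-bounded derivations from decision trees.

update : Fin N → Bool → Assignment N → Assignment N
update x b α y = if does (y Finₚ.≟ x) then b else α y

update-same : (x : Fin N) (b : Bool) (α : Assignment N) → update x b α x ≡ b
update-same x b α with x Finₚ.≟ x
... | yes _  = refl
... | no x≢x = contradiction refl x≢x

update-other : {x y : Fin N} {b : Bool} {α : Assignment N} → y ≢ x → update x b α y ≡ α y
update-other {x = x} {y} y≢x with y Finₚ.≟ x
... | yes y≡x = contradiction y≡x y≢x
... | no _    = refl

-- Refutations read off a decision tree: Derivable d C says that some part of C
-- is derived by a tree of depth d, all of whose clauses have width at most w,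
-- on top of any configuration leaving enough of the space s.
module DecisionTree (F : CNF) (w s : ℕ) where
  private
    V : ℕ
    V = numVars F
    Q : ClauseSet V → Set
    Q ℂ = totalWidth ℂ ≤ s

  open Bounded F Q (λ {𝔸} {𝔹} sub → ≤-trans (totalWidth-mono {𝔹 = 𝔹} {𝔸} sub))

  record Derivable (d : ℕ) (C : Clause V) : Set where
    constructor derivable
    field
      part    : Clause V
      part-⊆  : part ⊆ₗ C
      -- One clause waits at each level above, and the inference at a lowest inner node holds two
      -- premises and the resolvent: (d - 1) + 3 clauses of width at most `w`.
      reaches : ∀ ℂ → totalWidth ℂ + w * (2 + d) ≤ s → Reaches ℂ (part ∷ ℂ)

  axiom-derivable : ∀ {C} → C ∈ clauses F → width C ≤ w → Derivable 0 C
  axiom-derivable {C} C∈F C≤w = derivable C id λ ℂ h → downloads C∈F (begin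
      totalWidth (C ∷ ℂ)      ≤⟨ totalWidth-∷ C ℂ ⟩
      width C + totalWidth ℂ  ≡⟨ +-comm (width C) _ ⟩
      totalWidth ℂ + width C  ≤⟨ +-monoʳ-≤ (totalWidth ℂ) (≤-trans C≤w (m≤m*n w 2)) ⟩
      totalWidth ℂ + w * 2    ≤⟨ h ⟩
      s                       ∎)
    where open ≤-Reasoning

  weaken : ∀ {d d′ C D} → d ≤ d′ → C ⊆ₗ D → Derivable d C → Derivable d′ D
  weaken d≤d′ C⊆D (derivable C′ sub r) = derivable C′ (λ e → C⊆D (sub e))
    λ ℂ h → r ℂ (≤-trans (+-monoʳ-≤ (totalWidth ℂ) (*-monoʳ-≤ w (+-monoʳ-≤ 2 d≤d′))) h)

  resolve : ∀ {d x C C⁺ C⁻} → width C ≤ w → width C⁺ ≤ w → width C⁻ ≤ w →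
            (∀ {y b} → (y , b) ∈ₗ C⁺ → (y , b) ∈ₗ C ⊎ (y , b) ≡ (x , true)) →
            (∀ {y b} → (y , b) ∈ₗ C⁻ → (y , b) ∈ₗ C ⊎ (y , b) ≡ (x , false)) →
            (∀ {b} → ¬ (x , b) ∈ₗ C) →
            Derivable d C⁺ → Derivable d C⁻ → Derivable (suc d) C
  resolve {d} {x} {C} {C⁺} {C⁻} w₀ w₁ w₂ h⁺ h⁻ x∉C (derivable P P⊆ reachP) (derivable P′ P′⊆ reachP′)
    with lookup P x in eqP | lookup P′ x in eqP′
  -- A premise that lacks the pivot is already a part of `C`, so no inference is made.
  ... | nothing | _       = weaken {C = C} (n≤1+n d) id (derivable P sub reachP)
    where
    sub : P ⊆ₗ C
    sub e with h⁺ (P⊆ e)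
    ... | inj₁ e′   = e′
    ... | inj₂ refl with () ← trans (sym eqP) e
  ... | just _  | nothing = weaken {C = C} (n≤1+n d) id (derivable P′ sub reachP′)
    where
    sub : P′ ⊆ₗ C
    sub e with h⁻ (P′⊆ e)
    ... | inj₁ e′   = e′
    ... | inj₂ refl with () ← trans (sym eqP′) e
  ... | just b  | just b′ = derivable R R⊆C reach
    where
    entry : Fin V → Maybe Bool
    entry y = if does (y Finₚ.≟ x) then nothing else lookup P y <∣> lookup P′ y

    R : Clause V
    R = Vec.tabulate entry

    P-old : ∀ {y b} → y ≢ x → (y , b) ∈ₗ P → (y , b) ∈ₗ C
    P-old y≢x e with h⁺ (P⊆ e)
    ... | inj₁ e′   = e′
    ... | inj₂ refl = contradiction refl y≢x

    P′-old : ∀ {y b} → y ≢ x → (y , b) ∈ₗ P′ → (y , b) ∈ₗ C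
    P′-old y≢x e with h⁻ (P′⊆ e)
    ... | inj₁ e′   = e′
    ... | inj₂ refl = contradiction refl y≢x

    entry⁻ : ∀ {y b} → entry y ≡ just b → y ≢ x × ((y , b) ∈ₗ P ⊎ (y , b) ∈ₗ P′)
    entry⁻ {y} e with y Finₚ.≟ x
    ... | no y≢x with lookup P y
    ...   | just _  = y≢x , inj₁ e
    ...   | nothing = y≢x , inj₂ e

    entry⁺ : ∀ {y b} → y ≢ x → (y , b) ∈ₗ P ⊎ (y , b) ∈ₗ P′ → entry y ≡ just b
    entry⁺ {y} y≢x e with y Finₚ.≟ x
    ... | yes y≡x = contradiction y≡x y≢x
    ... | no _ with lookup P y in eq | e
    ...   | just _  | inj₁ e₁ = e₁
    ...   | nothing | inj₂ e₂ = e₂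
    -- Away from the pivot both premises are parts of `C`, so they cannot clash.
    ...   | just _  | inj₂ e₂ = trans (sym (P-old y≢x eq)) (P′-old y≢x e₂)

    R⁻ : ∀ {y b} → (y , b) ∈ₗ R → y ≢ x × ((y , b) ∈ₗ P ⊎ (y , b) ∈ₗ P′)
    R⁻ {y} e = entry⁻ (trans (sym (lookup∘tabulate entry y)) e)

    R⊆C : R ⊆ₗ C
    R⊆C e with R⁻ e
    ... | y≢x , inj₁ e₁ = P-old y≢x e₁
    ... | y≢x , inj₂ e₂ = P′-old y≢x e₂

    positive : (x , true) ∈ₗ P
    positive with h⁺ (P⊆ eqP)
    ... | inj₁ e    = contradiction e x∉C
    ... | inj₂ refl = eqP

    negative : (x , false) ∈ₗ P′
    negative with h⁻ (P′⊆ eqP′)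
    ... | inj₁ e    = contradiction e x∉C
    ... | inj₂ refl = eqP′

    resolvent : Resolvent P P′ R
    resolvent = record
      { pivot = x ; positive = positive ; negative = negative
      ; union = λ y b → mk⇔ R⁻ λ { (y≢x , e) → trans (lookup∘tabulate entry y) (entry⁺ y≢x e) } }

    open ≤-Reasoning

    wP : width P ≤ w
    wP = ≤-trans (width-mono P C⁺ P⊆) w₁

    reach : ∀ ℂ → totalWidth ℂ + w * (3 + d) ≤ s → Reaches ℂ (R ∷ ℂ)
    reach ℂ h =
      reachP ℂ (≤-trans (+-monoʳ-≤ t (*-monoʳ-≤ w (n≤1+n (2 + d)))) h)
      ▻ reachP′ (P ∷ ℂ) two
      ▻ erase (≤-trans (totalWidth-mono {𝔹 = P′ ∷ R ∷ ℂ} {P ∷ P′ ∷ R ∷ ℂ} there) three)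
          (erase three
            (rearrange rot (infers (there (here refl)) (here refl) resolvent
              (≤-trans (totalWidth-mono {𝔹 = R ∷ P′ ∷ P ∷ ℂ} {P ∷ P′ ∷ R ∷ ℂ} (λ p → rot .from p)) three))))
      where
      t = totalWidth ℂ

      two : totalWidth (P ∷ ℂ) + w * (2 + d) ≤ s
      two = begin
        totalWidth (P ∷ ℂ) + w * (2 + d)   ≤⟨ +-monoˡ-≤ _ (≤-trans (totalWidth-∷ P ℂ) (+-monoˡ-≤ t wP)) ⟩
        w + t + w * (2 + d)                ≡⟨ cong (_+ w * (2 + d)) (+-comm w t) ⟩
        t + w + w * (2 + d)                ≡⟨ +-assoc t w _ ⟩
        t + (w + w * (2 + d))              ≡⟨ cong (t +_) (*-suc w (2 + d)) ⟨
        t + w * (3 + d)                    ≤⟨ h ⟩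
        s                                  ∎

      three : totalWidth (P ∷ P′ ∷ R ∷ ℂ) ≤ s
      three = begin
        totalWidth (P ∷ P′ ∷ R ∷ ℂ)        ≤⟨ ≤-trans (totalWidth-∷ P (P′ ∷ R ∷ ℂ)) (+-mono-≤ wP
                                               (≤-trans (totalWidth-∷ P′ (R ∷ ℂ))
                                                   (+-mono-≤ (≤-trans (width-mono P′ C⁻ P′⊆) w₂)
                                               (≤-trans (totalWidth-∷ R ℂ)
                                                   (+-monoˡ-≤ t (≤-trans (width-mono R C R⊆C) w₀)))))) ⟩
        w + (w + (w + t))                  ≡⟨ cong (w +_) (+-assoc w w t) ⟨
        w + (w + w + t)                    ≡⟨ +-assoc w (w + w) t ⟨
        w + (w + w) + t                    ≡⟨ cong (λ u → w + (w + u) + t) (+-identityʳ w) ⟨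
        3 * w + t                          ≡⟨ +-comm (3 * w) t ⟩
        t + 3 * w                          ≡⟨ cong (t +_) (*-comm 3 w) ⟩
        t + w * 3                          ≤⟨ +-monoʳ-≤ t (*-monoʳ-≤ w (m≤m+n 3 d)) ⟩
        t + w * (3 + d)                    ≤⟨ h ⟩
        s                                  ∎

      rot : (P ∷ P′ ∷ R ∷ ℂ) ∼[ set ] (R ∷ P′ ∷ P ∷ ℂ)
      rot = mk⇔
        (λ { (here p) → there (there (here p)) ; (there (here p)) → there (here p)
           ; (there (there (here p))) → here p ; (there (there (there p))) → there (there (there p)) })
        (λ { (here p) → there (there (here p)) ; (there (here p)) → there (here p)
           ; (there (there (here p))) → here p ; (there (there (there p))) → there (there (there p)) })

  -- A query of `x`: the answer `false` leads to the premise with the positive literal, since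
  -- `blocking` negates. The hypothesis ranges over all `β` agreeing with `α` on `S` so as to cover
  -- both answers.
  branch : ∀ {d S x α} → x ∉ S → suc (length S) ≤ w →
           (∀ {β} → (∀ {y} → y ∈ S → β y ≡ α y) → Derivable d (blocking β (x ∷ S))) →
           Derivable (suc d) (blocking α S)
  branch {d} {S} {x} {α} x∉S len≤w h =
    resolve {x = x} {C = blocking α S} {C⁺ = blocking (update x false α) (x ∷ S)} {C⁻ = blocking
        (update x true α) (x ∷ S)}
      (≤-trans (width-blocking-≤ {β = α} {S}) (<⇒≤ len≤w))
      (≤-trans (width-blocking-≤ {β = update x false α} {x ∷ S}) len≤w)
      (≤-trans (width-blocking-≤ {β = update x true α} {x ∷ S}) len≤w)
      (split false) (split true)
      (λ e → x∉S (proj₁ (∈-blocking⁻ {β = α} {S} e)))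
      (h (agree false)) (h (agree true))
    where
    agree : ∀ b {y} → y ∈ S → update x b α y ≡ α y
    agree b y∈S = update-other {α = α} λ { refl → x∉S y∈S }

    split : ∀ b {y c} → (y , c) ∈ₗ blocking (update x b α) (x ∷ S) → (y , c) ∈ₗ blocking α S ⊎ (y , c) ≡ (x , not b)
    split b {y} e with ∈-blocking⁻ {β = update x b α} {x ∷ S} e
    ... | here refl , refl = inj₂ (cong (λ c → x , not c) (update-same x b α))
    ... | there y∈S , refl = inj₁ (subst (λ c → (y , not c) ∈ₗ blocking α S) (sym (agree b y∈S))
                                        (∈-blocking⁺ {β = α} {S} y∈S))

  -- A variable already in `S` is skipped, so `K` may contain repetitions and overlap with `S`; the
  -- depth is then merely overestimated.
  query : ∀ K {d S α} → length K + length S ≤ w →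
          (∀ {β} → (∀ {y} → y ∈ S → β y ≡ α y) → Derivable d (blocking β (K ++ S))) →
          Derivable (length K + d) (blocking α S)
  query []      _ h = h (λ _ → refl)
  query (x ∷ K) {d} {S} {α} len≤w h with x ∈? S
  ... | yes x∈S = weaken (n≤1+n _) id (query K (<⇒≤ len≤w) λ agr →
          weaken ≤-refl (blocking-mono drop-x (λ _ → refl)) (h agr))
    where
    drop-x : x ∷ K ++ S ⊆ K ++ S
    drop-x (here refl) = ∈-++⁺ʳ K x∈S
    drop-x (there p)   = p
  ... | no x∉S = branch x∉S (≤-trans (s≤s (m≤n+m (length S) (length K))) len≤w) λ agr →
          query K (subst (_≤ w) (sym (+-suc (length K) (length S))) len≤w) λ agr′ →
            weaken ≤-refl (blocking-mono move-x (λ _ → refl)) (h λ y∈S → trans (agr′ (there y∈S)) (agr y∈S))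
    where
    move-x : x ∷ K ++ S ⊆ K ++ x ∷ S
    move-x (here refl) = ∈-++⁺ʳ K (here refl)
    move-x (there p) with ∈-++⁻ K p
    ... | inj₁ q = ∈-++⁺ˡ q
    ... | inj₂ q = ∈-++⁺ʳ K (there q)

-- Random restrictions, derandomised.

Option : Set
Option = Bool × Bool

-- A vector will stand for a clause and record, for each grid line it touches, an option that
-- satisfies it. Choosing this option for the line removes the clause from consideration.
kills : Option → Maybe Option → Bool
kills o nothing   = false
kills o (just o′) = does (≡-dec Boolₚ._≟_ Boolₚ._≟_ o o′)

kills⁻ : ∀ o h → kills o h ≡ true → h ≡ just o
kills⁻ o (just o′) e with ≡-dec Boolₚ._≟_ Boolₚ._≟_ o o′
... | yes refl = refl

-- weight v / 4^L is the probability that a uniformly random Vec Option L disagrees with v everywhere.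
weight : ∀ {L} → Vec (Maybe Option) L → ℕ
weight []            = 1
weight (just _ ∷ v)  = 3 * weight v
weight (nothing ∷ v) = 4 * weight v

weights : ∀ {L} → List (Vec (Maybe Option) L) → ℕ
weights vs = sum (map weight vs)

residual : ∀ {L} → Option → List (Vec (Maybe Option) (suc L)) → List (Vec (Maybe Option) L)
residual o []             = []
residual o ((h ∷ v) ∷ vs) = if kills o h then residual o vs else v ∷ residual o vs

contribution : ∀ {L} → Option → Vec (Maybe Option) (suc L) → ℕ
contribution o (h ∷ v) = if kills o h then 0 else weight v

weights-residual : ∀ {L} o v (vs : List (Vec (Maybe Option) (suc L))) →
                   weights (residual o (v ∷ vs)) ≡ contribution o v + weights (residual o vs)
weights-residual o (h ∷ v) vs with kills o h
... | true  = refl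
... | false = refl

sumOptions : (Option → ℕ) → ℕ
sumOptions f = f (true , true) + f (true , false) + (f (false , true) + f (false , false))

sumOptions-+ : ∀ f g → sumOptions (λ o → f o + g o) ≡ sumOptions f + sumOptions g
sumOptions-+ f g = solve 8 (λ a b c d a′ b′ c′ d′ →
  a :+ a′ :+ (b :+ b′) :+ (c :+ c′ :+ (d :+ d′)) := a :+ b :+ (c :+ d) :+ (a′ :+ b′ :+ (c′ :+ d′)))
  refl (f (true , true)) (f (true , false)) (f (false , true)) (f (false , false))
       (g (true , true)) (g (true , false)) (g (false , true)) (g (false , false))
  where open +-*-Solver

sumOptions-cong : ∀ {f g} → (∀ o → f o ≡ g o) → sumOptions f ≡ sumOptions g
sumOptions-cong h = cong₂ _+_ (cong₂ _+_ (h _) (h _)) (cong₂ _+_ (h _) (h _))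

sumOptions-contribution : ∀ {L} (v : Vec (Maybe Option) (suc L)) → sumOptions (λ o → contribution o v) ≡ weight v
sumOptions-contribution (h ∷ v) = go h
  where
  open +-*-Solver
  x = weight v
  go : ∀ h → sumOptions (λ o → contribution o (h ∷ v)) ≡ weight (h ∷ v)
  go nothing                = solve 1 (λ x → x :+ x :+ (x :+ x) := con 4 :* x) refl x
  go (just (true  , true))  = solve 1 (λ x → con 0 :+ x :+ (x :+ x) := con 3 :* x) refl x
  go (just (true  , false)) = solve 1 (λ x → x :+ con 0 :+ (x :+ x) := con 3 :* x) refl x
  go (just (false , true))  = solve 1 (λ x → x :+ x :+ (con 0 :+ x) := con 3 :* x) refl x
  go (just (false , false)) = solve 1 (λ x → x :+ x :+ (x :+ con 0) := con 3 :* x) refl x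

-- An entry `nothing` survives all four options and an entry `just` all but one, whence the factors
-- 4 and 3 in `weight`. Since the four residual weights add up to the given one, one of them is at
-- most a quarter of it.
sumOptions-residual : ∀ {L} (vs : List (Vec (Maybe Option) (suc L))) →
                      sumOptions (λ o → weights (residual o vs)) ≡ weights vs
sumOptions-residual []       = refl
sumOptions-residual (v ∷ vs) = begin
  sumOptions (λ o → weights (residual o (v ∷ vs)))                 ≡⟨ sumOptions-cong
      (λ o → weights-residual o v vs) ⟩
  sumOptions (λ o → contribution o v + weights (residual o vs))
    ≡⟨ sumOptions-+ (λ o → contribution o v) (λ o → weights (residual o vs)) ⟩
  sumOptions (λ o → contribution o v) + sumOptions (λ o → weights (residual o vs))
    ≡⟨ cong₂ _+_ (sumOptions-contribution v) (sumOptions-residual vs) ⟩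
  weights (v ∷ vs)                                                 ∎
  where open ≡-Reasoning

someOption-< : ∀ f {k} → sumOptions f < 4 * k → ∃[ o ] f o < k
someOption-< f {k} h with f (true , true) <? k | f (true , false) <? k | f (false , true) <? k | f
    (false , false) <? k
... | yes p | _     | _     | _     = _ , p
... | no _  | yes p | _     | _     = _ , p
... | no _  | no _  | yes p | _     = _ , p
... | no _  | no _  | no _  | yes p = _ , p
... | no p₁ | no p₂ | no p₃ | no p₄ = contradiction h (≤⇒≯ (begin
  4 * k            ≡⟨ solve 1 (λ k → con 4 :* k := k :+ k :+ (k :+ k)) refl k ⟩
  k + k + (k + k)  ≤⟨ +-mono-≤ (+-mono-≤ (≮⇒≥ p₁) (≮⇒≥ p₂)) (+-mono-≤ (≮⇒≥ p₃) (≮⇒≥ p₄)) ⟩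
  sumOptions f     ∎))
  where
  open ≤-Reasoning
  open +-*-Solver

∈-residual : ∀ {L} {o h} {v : Vec (Maybe Option) L} {vs} → (h ∷ v) ∈ vs → h ≡ just o ⊎ v ∈ residual o vs
∈-residual {o = o} {h} {v} (here refl) with kills o h in eq
... | true  = inj₁ (kills⁻ o h eq)
... | false = inj₂ (here refl)
∈-residual {o = o} {vs = (h′ ∷ _) ∷ vs} (there p) with kills o h′ | ∈-residual {o = o} p
... | _     | inj₁ e = inj₁ e
... | true  | inj₂ q = inj₂ q
... | false | inj₂ q = inj₂ (there q)

-- The method of conditional expectations.
hitting : ∀ L (vs : List (Vec (Maybe Option) L)) → weights vs < 4 ^ L →
          ∃[ ρ ] (∀ {v} → v ∈ vs → ∃[ i ] lookup v i ≡ just (lookup ρ i))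
hitting zero    []        _ = [] , λ ()
hitting zero    ([] ∷ vs) h = contradiction h (≤⇒≯ (s≤s z≤n))
hitting (suc L) vs        h
  with o , h′ ← someOption-< (λ o → weights (residual o vs)) (subst (_< 4 ^ suc L) (sym (sumOptions-residual vs)) h)
  with ρ , hit ← hitting L (residual o vs) h′ = o ∷ ρ , hit′
  where
  hit′ : ∀ {v} → v ∈ vs → ∃[ i ] lookup v i ≡ just (lookup (o ∷ ρ) i)
  hit′ {h ∷ v} p with ∈-residual {o = o} p
  ... | inj₁ e = zero , e
  ... | inj₂ q = let i , e = hit q in suc i , e

-- Each of `w` touched positions lowers the probability of escaping by a factor 3/4, and every
-- further position by a factor of at most 1. Denominators are cleared.
weight-≤ : ∀ {L} w (v : Vec (Maybe Option) L) → w ≤ length (support v) → weight v * 4 ^ w ≤ 3 ^ w * 4 ^ L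
weight-≤ zero    []            _ = ≤-refl
weight-≤ {suc L} w (nothing ∷ v) h = begin
  4 * weight v * 4 ^ w    ≡⟨ *-assoc 4 (weight v) (4 ^ w) ⟩
  4 * (weight v * 4 ^ w)  ≤⟨ *-monoʳ-≤ 4 (weight-≤ w v (subst (w ≤_) (length-map suc (support v)) h)) ⟩
  4 * (3 ^ w * 4 ^ L)     ≡⟨ solve 2 (λ x y → con 4 :* (x :* y) := x :* (con 4 :* y)) refl (3 ^ w) (4 ^ L) ⟩
  3 ^ w * 4 ^ suc L       ∎
  where
  open ≤-Reasoning
  open +-*-Solver
weight-≤ {suc L} zero (just _ ∷ v) _ = begin
  3 * weight v * 1    ≡⟨ *-assoc 3 (weight v) 1 ⟩
  3 * (weight v * 1)  ≤⟨ *-mono-≤ (n≤1+n 3) (weight-≤ zero v z≤n) ⟩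
  4 * (1 * 4 ^ L)     ≡⟨ cong (4 *_) (*-identityˡ (4 ^ L)) ⟩
  4 ^ suc L           ≡⟨ *-identityˡ (4 ^ suc L) ⟨
  1 * 4 ^ suc L       ∎
  where open ≤-Reasoning
weight-≤ {suc L} (suc w) (just _ ∷ v) (s≤s h) = begin
  3 * weight v * (4 * 4 ^ w)  ≡⟨ solve 2 (λ x y → con 3 :* x :* (con 4 :* y) := con 12 :* (x :* y)) refl
      (weight v) (4 ^ w) ⟩
  12 * (weight v * 4 ^ w)     ≤⟨ *-monoʳ-≤ 12 (weight-≤ w v (subst (w ≤_) (length-map suc (support v)) h)) ⟩
  12 * (3 ^ w * 4 ^ L)        ≡⟨ solve 2 (λ x y → con 12 :* (x :* y) := con 3 :* x :* (con 4 :* y)) refl (3 ^ w)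
      (4 ^ L) ⟩
  3 ^ suc w * 4 ^ suc L       ∎
  where
  open ≤-Reasoning
  open +-*-Solver

-- The union bound: on average fewer than one vector escapes a random choice.
hitting-wide : ∀ {L} w (vs : List (Vec (Maybe Option) L)) → (∀ {v} → v ∈ vs → w ≤ length (support v)) →
               length vs * 3 ^ w < 4 ^ w → ∃[ ρ ] (∀ {v} → v ∈ vs → ∃[ i ] lookup v i ≡ just (lookup ρ i))
hitting-wide {L} w vs wide few = hitting L vs (*-cancelʳ-< (4 ^ w) (weights vs) (4 ^ L) (begin-strict
  weights vs * 4 ^ w          ≤⟨ total vs wide ⟩
  length vs * (3 ^ w * 4 ^ L) ≡⟨ *-assoc (length vs) (3 ^ w) (4 ^ L) ⟨
  length vs * 3 ^ w * 4 ^ L   <⟨ *-monoˡ-< (4 ^ L) {{m^n≢0 4 L}} few ⟩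
  4 ^ w * 4 ^ L               ≡⟨ *-comm (4 ^ w) (4 ^ L) ⟩
  4 ^ L * 4 ^ w               ∎))
  where
  open ≤-Reasoning
  total : ∀ vs → (∀ {v} → v ∈ vs → w ≤ length (support v)) → weights vs * 4 ^ w ≤ length vs * (3 ^ w * 4 ^ L)
  total []       _    = z≤n
  total (v ∷ vs) wide = begin
    (weight v + weights vs) * 4 ^ w                  ≡⟨ *-distribʳ-+ (4 ^ w) (weight v) (weights vs) ⟩
    weight v * 4 ^ w + weights vs * 4 ^ w
      ≤⟨ +-mono-≤ (weight-≤ w v (wide (here refl))) (total vs (wide ∘ there)) ⟩
    length (v ∷ vs) * (3 ^ w * 4 ^ L)                ∎

-- Parities, and enumeration of the assignments on finitely many variables.

parity : Assignment N → List (Fin N) → Bool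
parity α = foldr (λ x b → α x xor b) false

parity-++ : (α : Assignment N) (xs ys : List (Fin N)) → parity α (xs ++ ys) ≡ parity α xs xor parity α ys
parity-++ α []       ys = refl
parity-++ α (x ∷ xs) ys = trans (cong (α x xor_) (parity-++ α xs ys)) (sym (Boolₚ.xor-assoc (α x) _ _))

parity-cong : {α β : Assignment N} (xs : List (Fin N)) → (∀ {x} → x ∈ xs → α x ≡ β x) → parity α xs ≡ parity β xs
parity-cong []       _ = refl
parity-cong (x ∷ xs) h = cong₂ _xor_ (h (here refl)) (parity-cong xs (h ∘ there))

parity-differ : {α β : Assignment N} (xs : List (Fin N)) → parity α xs ≢ parity β xs →
                ∃[ x ] (x ∈ xs × α x ≢ β x)
parity-differ []       h = contradiction refl h
parity-differ {α = α} {β} (x ∷ xs) h with α x Boolₚ.≟ β x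
... | no ne = x , here refl , ne
... | yes e with parity-differ xs (λ e′ → h (cong₂ _xor_ e e′))
...   | y , y∈ , ne = y , there y∈ , ne

parity-xor : (α β : Assignment N) (xs : List (Fin N)) →
             parity (λ x → α x xor β x) xs ≡ parity α xs xor parity β xs
parity-xor α β []       = refl
parity-xor α β (x ∷ xs) = trans (cong ((α x xor β x) xor_) (parity-xor α β xs))
  (solve 4 (λ a b c d → (a :+ b) :+ (c :+ d) := (a :+ c) :+ (b :+ d)) refl (α x) (β x) (parity α xs) (parity β xs))
  where open xor-∧-Solver

assignmentsOn : List (Fin N) → List (Assignment N)
assignmentsOn []       = [ const true ]
assignmentsOn (x ∷ xs) = map (update x true) (assignmentsOn xs) ++ map (update x false) (assignmentsOn xs)

length-assignmentsOn : (xs : List (Fin N)) → length (assignmentsOn xs) ≡ 2 ^ length xs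
length-assignmentsOn []       = refl
length-assignmentsOn (x ∷ xs) = trans (Listₚ.length-++ (map (update x true) as)) (cong₂ _+_
  (trans (length-map _ as) (length-assignmentsOn xs))
  (trans (trans (length-map _ as) (length-assignmentsOn xs)) (sym (+-identityʳ _))))
  where as = assignmentsOn xs

-- Agreement on `xs` is all that can be asked of functions enumerated up to their values there, and
-- all that `blocking` depends on.
assignmentsOn-complete : (α : Assignment N) (xs : List (Fin N)) →
                         ∃[ β ] (β ∈ assignmentsOn xs × (∀ {y} → y ∈ xs → β y ≡ α y))
assignmentsOn-complete α []       = const true , here refl , λ ()
assignmentsOn-complete α (x ∷ xs) with assignmentsOn-complete α xs
... | β , β∈ , agree = update x (α x) β , member (α x) , agree′
  where
  member : ∀ b → update x b β ∈ assignmentsOn (x ∷ xs)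
  member true  = ∈-++⁺ˡ (∈-map⁺ (update x true) β∈)
  member false = ∈-++⁺ʳ (map (update x true) (assignmentsOn xs)) (∈-map⁺ (update x false) β∈)

  agree′ : ∀ {y} → y ∈ x ∷ xs → update x (α x) β y ≡ α y
  agree′ {y} p with y Finₚ.≟ x | p
  ... | yes refl | _         = refl
  ... | no y≢x   | here y≡x  = contradiction y≡x y≢x
  ... | no y≢x   | there y∈  = agree y∈

-- The formula and its size.

length-cartesianProduct : {B : Set} (xs : List A) (ys : List B) →
                          length (cartesianProduct xs ys) ≡ length xs * length ys
length-cartesianProduct []       ys = refl
length-cartesianProduct (x ∷ xs) ys = trans (Listₚ.length-++ (map (x ,_) ys))
  (cong₂ _+_ (length-map (x ,_) ys) (length-cartesianProduct xs ys))

-- Abstract, so that the numeral is never unfolded.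
abstract
  cellCost : ℕ
  -- A cell has at most 8 variables, and `y₀` is the ninth: at most `2 ^ 9` clauses of width at most
  -- 9.
  cellCost = 2 ^ 9 * 9

  cellCost-≥ : {l t c : ℕ} → l ≤ 2 ^ suc t → t ≤ 8 → c ≤ l * 9 → c ≤ cellCost
  cellCost-≥ l≤ t≤8 c≤ = ≤-trans c≤ (*-monoˡ-≤ 9 (≤-trans l≤ (^-monoʳ-≤ 2 (s≤s t≤8))))

-- Tseitin formula of the (M+1) × (M+1) grid with charge 1 at the origin only.
-- Lines are the rows (direction true) and the columns (direction false); the
-- edge between positions j and j+1 of a line carries two variables, whose sum
-- modulo 2 is the value of the edge.
module Formula (M K : ℕ) where

  m : ℕ
  m = suc M

  Line : Set
  Line = Fin (m + m)

  Variable : Set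
  Variable = ((Line × Fin M) × Bool) ⊎ (Fin (suc K) ⊎ Fin (2 + K))

  V : ℕ
  V = (m + m) * M * 2 + (suc K + (2 + K))

  variable↔ : Fin V ↔ Variable
  variable↔ = (((Finₚ.*↔× ×-↔ Finₚ.2↔Bool) ↔-∘ Finₚ.*↔×) ⊎-↔ Finₚ.+↔⊎) ↔-∘ Finₚ.+↔⊎

  decode : Fin V → Variable
  decode = Inverse.to variable↔

  encode : Variable → Fin V
  encode = Inverse.from variable↔

  decode-encode : ∀ v → decode (encode v) ≡ v
  decode-encode v = Inverse.strictlyInverseˡ variable↔ v

  encode-decode : ∀ x → encode (decode x) ≡ x
  encode-decode x = Inverse.strictlyInverseʳ variable↔ x

  encode-injective : ∀ {u v} → encode u ≡ encode v → u ≡ v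
  encode-injective {u} {v} e = trans (sym (decode-encode u)) (trans (cong decode e) (decode-encode v))

  tvar : Line → Fin M → Bool → Fin V
  tvar ℓ j i = encode (inj₁ ((ℓ , j) , i))

  yvar : Fin (suc K) → Fin V
  yvar i = encode (inj₂ (inj₁ i))

  zvar : Fin (2 + K) → Fin V
  zvar i = encode (inj₂ (inj₂ i))

  y₀ : Fin V
  y₀ = yvar zero

  ys zs : List (Fin V)
  ys = map yvar (tabulate suc)
  zs = map zvar (allFin (2 + K))

  y₀∷ys-unique : Unique (y₀ ∷ ys)
  y₀∷ys-unique = Unique.map⁺ {f = yvar} (λ e → inj₁-injective (inj₂-injective (encode-injective e)))
      (Unique.allFin⁺ (suc K))

  zs-unique : Unique zs
  zs-unique = Unique.map⁺ {f = zvar} (λ e → inj₂-injective (inj₂-injective (encode-injective e)))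
      (Unique.allFin⁺ (2 + K))

  length-y₀∷ys : length (y₀ ∷ ys) ≡ suc K
  length-y₀∷ys = trans (length-map yvar (allFin (suc K))) (Listₚ.length-tabulate id)

  length-zs : length zs ≡ 2 + K
  length-zs = trans (length-map zvar (allFin (2 + K))) (Listₚ.length-tabulate id)

  line : Bool → Fin m → Line
  line true  r = r Fin.↑ˡ m
  line false c = m Fin.↑ʳ c

  -- Empty beyond the grid.
  edge : Bool → ℕ → ℕ → List (Fin V)
  edge d a j with a <? m | j <? M
  ... | yes a<m | yes j<M = tvar ℓ (fromℕ< j<M) true ∷ tvar ℓ (fromℕ< j<M) false ∷ []
    where ℓ = line d (fromℕ< a<m)
  ... | yes _   | no _    = []
  ... | no _    | _       = []

  -- Indexing an edge by the position after it lets `cell` treat the border uniformly: position 0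
  -- has no edge before it, and the edge after the last position is empty by `edge`.
  before : Bool → ℕ → ℕ → List (Fin V)
  before d a zero    = []
  before d a (suc j) = edge d a j

  cell : ℕ → ℕ → List (Fin V)
  cell p q = (before true p q ++ before true p (suc q)) ++ (before false q p ++ before false q (suc p))

  charge : ℕ → ℕ → Bool
  charge p q = (p ≡ᵇ 0) ∧ (q ≡ᵇ 0)

  -- The conjunct `β y₀` weakens each Tseitin clause by the negation of `y₀`.
  violates : ℕ → ℕ → Assignment V → Bool
  violates p q β = β y₀ ∧ (parity β (cell p q) xor charge p q)

  cellAxioms : ℕ × ℕ → ClauseSet V
  cellAxioms (p , q) = map (λ β → blocking β (y₀ ∷ cell p q))
                       (filter (λ β → violates p q β Boolₚ.≟ true) (assignmentsOn (y₀ ∷ cell p q)))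

  cells : List (ℕ × ℕ)
  cells = cartesianProduct (upTo m) (upTo m)

  gridAxioms : ClauseSet V
  gridAxioms = concat (map cellAxioms cells)

  formula : CNF
  formula = record { numVars = V
                   ; clauses = posClause (y₀ ∷ ys) ∷ posClause zs ∷ map negUnit ys ++ map negUnit zs ++ gridAxioms }

  data Axiom (C : Clause V) : Set where
    is-W : C ≡ posClause (y₀ ∷ ys) → Axiom C
    is-Z : C ≡ posClause zs → Axiom C
    is-y : ∀ {x} → x ∈ ys → C ≡ negUnit x → Axiom C
    is-z : ∀ {x} → x ∈ zs → C ≡ negUnit x → Axiom C
    is-cell : ∀ {p q β} → p < m → q < m → violates p q β ≡ true → C ≡ blocking β (y₀ ∷ cell p q) → Axiom C

  axiom⁻ : ∀ {C} → C ∈ clauses formula → Axiom C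
  axiom⁻ (here e) = is-W e
  axiom⁻ (there (here e)) = is-Z e
  axiom⁻ (there (there p)) with ∈-++⁻ (map negUnit ys) p
  ... | inj₁ p₁ = let _ , x∈ , e = ∈-map⁻ negUnit p₁ in is-y x∈ e
  ... | inj₂ p₂ with ∈-++⁻ (map negUnit zs) p₂
  ...   | inj₁ p₃ = let _ , x∈ , e = ∈-map⁻ negUnit p₃ in is-z x∈ e
  ...   | inj₂ p₄ with ∈-concat⁻′ (map cellAxioms cells) p₄
  ...     | Cs , C∈ , Cs∈ with ∈-map⁻ cellAxioms Cs∈
  ...       | (p , q) , pq∈ , refl with ∈-map⁻ (λ β → blocking β (y₀ ∷ cell p q)) C∈
  ...         | β , β∈ , e =
    let p∈ , q∈ = ∈-cartesianProduct⁻ (upTo m) (upTo m) pq∈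
        _ , bad = ∈-filter⁻ (λ β → violates p q β Boolₚ.≟ true) {xs = assignmentsOn (y₀ ∷ cell p q)} β∈
    in is-cell (∈-upTo⁻ p∈) (∈-upTo⁻ q∈) bad e

  y-axiom : ∀ {x} → x ∈ ys → negUnit x ∈ clauses formula
  y-axiom x∈ = there (there (∈-++⁺ˡ (∈-map⁺ negUnit x∈)))

  z-axiom : ∀ {x} → x ∈ zs → negUnit x ∈ clauses formula
  z-axiom x∈ = there (there (∈-++⁺ʳ (map negUnit ys) (∈-++⁺ˡ (∈-map⁺ negUnit x∈))))

  cell-axiom : ∀ {p q α} → p < m → q < m → violates p q α ≡ true → blocking α (y₀ ∷ cell p q) ∈ clauses formula
  cell-axiom {p} {q} {α} p<m q<m bad with assignmentsOn-complete α (y₀ ∷ cell p q)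
  ... | β , β∈ , agree = subst (_∈ clauses formula) same
    (there (there (∈-++⁺ʳ (map negUnit ys) (∈-++⁺ʳ (map negUnit zs) (∈-concat⁺′
      (∈-map⁺ (λ β → blocking β (y₀ ∷ cell p q)) (∈-filter⁺ (λ β → violates p q β Boolₚ.≟ true) β∈ bad′))
      (∈-map⁺ cellAxioms (∈-cartesianProduct⁺ (∈-upTo⁺ p<m) (∈-upTo⁺ q<m))))))))
    where
    bad′ : violates p q β ≡ true
    bad′ = trans (cong₂ _∧_ (agree (here refl)) (cong (_xor charge p q) (parity-cong (cell p q) (agree ∘ there)))) bad

    same : blocking β (y₀ ∷ cell p q) ≡ blocking α (y₀ ∷ cell p q)
    same = literal-ext (blocking-mono id agree) (blocking-mono id (sym ∘ agree))

  length-edge : ∀ d a j → length (edge d a j) ≤ 2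
  length-edge d a j with a <? m | j <? M
  ... | yes _ | yes _ = ≤-refl
  ... | yes _ | no _  = z≤n
  ... | no _  | _     = z≤n

  length-before : ∀ d a j → length (before d a j) ≤ 2
  length-before d a zero    = z≤n
  length-before d a (suc j) = length-edge d a j

  length-before-++ : ∀ d a j e b i → length (before d a j ++ before e b i) ≤ 4
  length-before-++ d a j e b i = subst (_≤ 4) (sym (Listₚ.length-++ (before d a j)))
    (+-mono-≤ (length-before d a j) (length-before e b i))

  length-cell : ∀ p q → length (cell p q) ≤ 8
  length-cell p q = subst (_≤ 8) (sym (Listₚ.length-++ (before true p q ++ before true p (suc q))))
    (+-mono-≤ (length-before-++ true p q true p (suc q)) (length-before-++ false q p false q (suc p)))

  size-≥ : suc K ≤ size formula
  size-≥ = begin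
    suc K                                  ≡⟨ length-y₀∷ys ⟨
    length (y₀ ∷ ys)                       ≡⟨ width-blocking {β = const false} y₀∷ys-unique ⟨
    width (posClause (y₀ ∷ ys))            ≡⟨ +-identityʳ _ ⟨
    sum (map width [ posClause (y₀ ∷ ys) ]) ≤⟨ sum-≤-totalWidth {ℂ = clauses formula} ([] ∷ [])
        (λ { (here refl) → here refl }) ⟩
    size formula                           ∎
    where open ≤-Reasoning

  private
    cell-total : ∀ p q → sum (map width (cellAxioms (p , q))) ≤ cellCost
    cell-total p q = cellCost-≥ (begin
        length (cellAxioms (p , q))     ≡⟨ length-map _ (filter P? as) ⟩
        length (filter P? as)           ≤⟨ Listₚ.length-filter P? as ⟩
        length as                       ≡⟨ length-assignmentsOn (y₀ ∷ cell p q) ⟩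
        2 ^ suc (length (cell p q))     ∎)
      (length-cell p q) (sum-≤ width 9 (cellAxioms (p , q)) narrow)
      where
      open ≤-Reasoning
      as = assignmentsOn (y₀ ∷ cell p q)
      P? = λ β → violates p q β Boolₚ.≟ true
      narrow : ∀ {C} → C ∈ cellAxioms (p , q) → width C ≤ 9
      narrow C∈ with ∈-map⁻ (λ β → blocking β (y₀ ∷ cell p q)) C∈
      ... | β , _ , refl = ≤-trans (width-blocking-≤ {β = β} {y₀ ∷ cell p q}) (s≤s (length-cell p q))

    sum-++ : (Cs Ds : ClauseSet V) → sum (map width (Cs ++ Ds)) ≡ sum (map width Cs) + sum (map width Ds)
    sum-++ Cs Ds = trans (cong sum (Listₚ.map-++ width Cs Ds)) (ListAction.sum-++ (map width Cs) (map width Ds))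

    concat-total : (c : ℕ) (f : ℕ × ℕ → ClauseSet V) → (∀ u → sum (map width (f u)) ≤ c) →
                   ∀ us → sum (map width (concat (map f us))) ≤ length us * c
    concat-total c f h []       = z≤n
    concat-total c f h (u ∷ us) = subst (_≤ c + length us * c) (sym (sum-++ (f u) (concat (map f us))))
      (+-mono-≤ (h u) (concat-total c f h us))

    length-cells : length cells ≡ m * m
    length-cells = trans (length-cartesianProduct (upTo m) (upTo m))
        (cong₂ _*_ (Listₚ.length-upTo m) (Listₚ.length-upTo m))

    units-total : ∀ xs → sum (map width (map negUnit xs)) ≤ length {A = Fin V} xs
    units-total xs = subst (sum (map width (map negUnit xs)) ≤_) (trans (*-identityʳ _) (length-map negUnit xs))
      (sum-≤ width 1 (map negUnit xs) λ C∈ → case ∈-map⁻ negUnit C∈ of λ { (x , _ , refl) → width-negUnit x })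

  size-≤ : size formula ≤ 2 * (suc K + (2 + K)) + m * m * cellCost
  size-≤ = begin
    size formula                                       ≤⟨ totalWidth-≤-sum (clauses formula) ⟩
    width W + (width Z + sum (map width (map negUnit ys ++ map negUnit zs ++ gridAxioms)))
      ≡⟨ cong (λ t → width W + (width Z + t)) (trans (sum-++ (map negUnit ys) (map negUnit zs ++ gridAxioms))
           (cong (sum (map width (map negUnit ys)) +_) (sum-++ (map negUnit zs) gridAxioms))) ⟩
    width W + (width Z + (sum (map width (map negUnit ys)) +
        (sum (map width (map negUnit zs)) + sum (map width gridAxioms))))
      ≤⟨ +-mono-≤ W≤ (+-mono-≤ Z≤ (+-mono-≤ Y′≤ (+-mono-≤ Z′≤ G≤))) ⟩
    suc K + (2 + K + (suc K + (2 + K + m * m * cellCost)))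
      ≡⟨ solve 3 (λ a b c → a :+ (b :+ (a :+ (b :+ c))) := con 2 :* (a :+ b) :+ c) refl (suc K) (2 + K)
          (m * m * cellCost) ⟩
    2 * (suc K + (2 + K)) + m * m * cellCost               ∎
    where
    open ≤-Reasoning
    open +-*-Solver
    W = posClause (y₀ ∷ ys)
    Z = posClause zs
    W≤ : width W ≤ suc K
    W≤ = subst (width W ≤_) length-y₀∷ys (width-blocking-≤ {β = const false} {y₀ ∷ ys})
    Z≤ : width Z ≤ 2 + K
    Z≤ = subst (width Z ≤_) length-zs (width-blocking-≤ {β = const false} {zs})
    Y′≤ : sum (map width (map negUnit ys)) ≤ suc K
    Y′≤ = ≤-trans (units-total ys) (≤-trans (n≤1+n _) (≤-reflexive length-y₀∷ys))
    Z′≤ : sum (map width (map negUnit zs)) ≤ 2 + K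
    Z′≤ = ≤-trans (units-total zs) (≤-reflexive length-zs)
    G≤ : sum (map width gridAxioms) ≤ m * m * cellCost
    G≤ = ≤-trans (concat-total cellCost cellAxioms (λ (p , q) → cell-total p q) cells)
        (≤-reflexive (cong (_* cellCost) length-cells))

-- Decision tree locating a violated cell in a rectangle of odd charge.

segment : (ℕ → List A) → ℕ → ℕ → List A
segment f p zero    = []
segment f p (suc a) = f p ++ segment f (suc p) a

segment-+ : (f : ℕ → List A) (p a b : ℕ) → segment f p (a + b) ≡ segment f p a ++ segment f (p + a) b
segment-+ f p zero    b = cong (λ p → segment f p b) (sym (+-identityʳ p))
segment-+ f p (suc a) b = trans (cong (f p ++_) (trans (segment-+ f (suc p) a b)
  (cong (λ p′ → segment f (suc p) a ++ segment f p′ b) (sym (+-suc p a)))))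
  (sym (Listₚ.++-assoc (f p) (segment f (suc p) a) (segment f (p + suc a) b)))

segment-mono : {f g : ℕ → List A} → (∀ i → f i ⊆ g i) → ∀ p a → segment f p a ⊆ segment g p a
segment-mono {f = f} {g} f⊆g p (suc a) x∈ with ∈-++⁻ (f p) x∈
... | inj₁ x∈f = ∈-++⁺ˡ (f⊆g p x∈f)
... | inj₂ x∈s = ∈-++⁺ʳ (g p) (segment-mono f⊆g (suc p) a x∈s)

segment-∪ : {f g : ℕ → List A} → ∀ p a → segment (λ i → f i ++ g i) p a ⊆ segment f p a ++ segment g p a
segment-∪ {f = f} {g} p (suc a) {x} x∈ with ∈-++⁻ (f p ++ g p) x∈
... | inj₁ x∈fg with ∈-++⁻ (f p) x∈fg
...   | inj₁ x∈f = ∈-++⁺ˡ (∈-++⁺ˡ x∈f)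
...   | inj₂ x∈g = ∈-++⁺ʳ (segment f p (suc a)) (∈-++⁺ˡ x∈g)
segment-∪ {f = f} {g} p (suc a) {x} x∈ | inj₂ x∈s with ∈-++⁻ (segment f (suc p) a) (segment-∪ (suc p) a x∈s)
...   | inj₁ x∈f = ∈-++⁺ˡ (∈-++⁺ʳ (f p) x∈f)
...   | inj₂ x∈g = ∈-++⁺ʳ (segment f p (suc a)) (∈-++⁺ʳ (g p) x∈g)

segment-[] : {f : ℕ → List A} → (∀ i → f i ≡ []) → ∀ p a → segment f p a ≡ []
segment-[] f≡[] p zero    = refl
segment-[] f≡[] p (suc a) = cong₂ _++_ (f≡[] p) (segment-[] f≡[] (suc p) a)

length-segment : {f : ℕ → List A} {c : ℕ} → (∀ i → length (f i) ≤ c) → ∀ p a → length (segment f p a) ≤ a * c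
length-segment         h p zero    = z≤n
length-segment {f = f} h p (suc a) = ≤-trans (≤-reflexive (Listₚ.length-++ (f p)))
  (+-mono-≤ (h p) (length-segment h (suc p) a))

parity-segment : {f g h : ℕ → List (Fin N)} (α : Assignment N) →
                 (∀ i → parity α (f i) xor parity α (g i) ≡ parity α (h i)) → ∀ p a →
                 parity α (segment f p a) xor parity α (segment g p a) ≡ parity α (segment h p a)
parity-segment α eq p zero    = refl
parity-segment {f = f} {g} {h} α eq p (suc a) = begin
  parity α (f p ++ F) xor parity α (g p ++ G)
    ≡⟨ cong₂ _xor_ (parity-++ α (f p) F) (parity-++ α (g p) G) ⟩
  (parity α (f p) xor parity α F) xor (parity α (g p) xor parity α G)
    ≡⟨ solve 4 (λ a b c d → (a :+ b) :+ (c :+ d) := (a :+ c) :+ (b :+ d)) refl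
         (parity α (f p)) (parity α F) (parity α (g p)) (parity α G) ⟩
  (parity α (f p) xor parity α (g p)) xor (parity α F xor parity α G)
    ≡⟨ cong₂ _xor_ (eq p) (parity-segment {f = f} {g} {h} α eq (suc p) a) ⟩
  parity α (h p) xor parity α (segment h (suc p) a)
    ≡⟨ parity-++ α (h p) (segment h (suc p) a) ⟨
  parity α (segment h p (suc a))  ∎
  where
  open ≡-Reasoning
  open xor-∧-Solver
  F = segment f (suc p) a
  G = segment g (suc p) a

-- Halving `a − 2` and adding 1 to each half keeps both nonempty. The last bound is what the depth
-- estimate in `split-solved` needs.
halve : ∀ a → 2 ≤ a → ∃[ a₁ ] ∃[ a₂ ] (a ≡ a₁ + a₂ × 1 ≤ a₁ × a₁ ≤ a₂ × a₂ ≤ 2 * a₁)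
halve (suc zero) (s≤s ())
halve (suc (suc n)) _ = suc ⌊ n /2⌋ , suc ⌈ n /2⌉ ,
  cong suc (trans (cong suc (sym (⌊n/2⌋+⌈n/2⌉≡n n))) (sym (+-suc _ _))) ,
  s≤s z≤n , s≤s (⌊n/2⌋≤⌈n/2⌉ n) ,
  s≤s (≤-trans (⌊n/2⌋-mono (n≤1+n (suc n))) (≤-trans (m≤m+n _ 0) (m≤n+m _ ⌊ n /2⌋)))

xor-true : ∀ {a b} → a xor b ≡ true → a ≡ true ⊎ b ≡ true
xor-true {true}  _ = inj₁ refl
xor-true {false} e = inj₂ e

varSp-≤ : {F : CNF} {s : ℕ} (π : Refutation F) → All (λ ℂ → totalWidth ℂ ≤ s) (configurations π) → varSp π ≤ s
varSp-≤ {F} {s} π = go (configurations π)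
  where
  go : ∀ ℂs → All (λ ℂ → totalWidth {numVars F} ℂ ≤ s) ℂs → foldr _⊔_ 0 (map totalWidth ℂs) ≤ s
  go []       []       = z≤n
  go (ℂ ∷ ℂs) (h ∷ hs) = ⊔-lub h (go ℂs hs)

module UpperBound (M K : ℕ) where
  open Formula M K

  -- The edges leaving the rectangle with corner `(p , q)` and sides `a` and `b`. The first
  -- coordinate counts rows if `d` is `true` and columns otherwise, so one argument covers cuts in
  -- both directions.
  boundary : Bool → ℕ → ℕ → ℕ → ℕ → List (Fin V)
  boundary d p q a b = segment (λ i → before d i q ++ before d i (q + b)) p a
                    ++ segment (λ j → before (not d) j p ++ before (not d) j (p + a)) q b

  w s : ℕ
  -- At most `2 * m` variables of a cut, `8 * m` of a boundary, and `y₀`, for which another `m` is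
  -- allowed.
  w = 11 * m
  s = 2 * suc K

  open DecisionTree formula w s

  -- A nonempty rectangle contains the origin only as its corner, so `charge p q` is its total
  -- charge. The assumption is that the boundary values contradict this charge.
  Solved : ℕ → Bool → ℕ → ℕ → ℕ → ℕ → Set
  Solved n d p q a b = ∀ {α} → α y₀ ≡ true → parity α (boundary d p q a b) xor charge p q ≡ true →
                       Derivable n (blocking α (y₀ ∷ boundary d p q a b))

  charge-comm : ∀ p q → charge p q ≡ charge q p
  charge-comm p q = Boolₚ.∧-comm (p ≡ᵇ 0) (q ≡ᵇ 0)

  transport : ∀ {α S T} → T ⊆ S → ∀ {n} → Derivable n (blocking α (y₀ ∷ T)) → Derivable n (blocking α (y₀ ∷ S))
  transport {α} {S} {T} T⊆S = weaken ≤-refl (blocking-mono {β = α} {α} {y₀ ∷ T} {y₀ ∷ S}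
    (λ { (here e) → here e ; (there x∈) → there (T⊆S x∈) }) (λ _ → refl))

  flip-solved : ∀ {n d p q a b} → Solved n (not d) q p b a → Solved n d p q a b
  flip-solved {n} {d} {p} {q} {a} {b} solved {α} y₀-true odd =
    transport {α} {boundary d p q a b} {boundary (not d) q p b a} (λ {x} x∈ → sub (subst (x ∈_) flipped x∈))
      (solved y₀-true (trans (cong₂ _xor_ parity≡ (charge-comm q p)) odd))
    where
    rows = segment (λ i → before d i q ++ before d i (q + b)) p a
    cols = segment (λ j → before (not d) j p ++ before (not d) j (p + a)) q b

    flipped : boundary (not d) q p b a ≡ cols ++ rows
    flipped = cong (λ d′ → cols ++ segment (λ i → before d′ i q ++ before d′ i (q + b)) p a) (Boolₚ.not-involutive d)

    sub : cols ++ rows ⊆ rows ++ cols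
    sub x∈ with ∈-++⁻ cols x∈
    ... | inj₁ x∈c = ∈-++⁺ʳ rows x∈c
    ... | inj₂ x∈r = ∈-++⁺ˡ x∈r

    parity≡ : parity α (boundary (not d) q p b a) ≡ parity α (boundary d p q a b)
    parity≡ = begin
      parity α (boundary (not d) q p b a)  ≡⟨ cong (parity α) flipped ⟩
      parity α (cols ++ rows)              ≡⟨ parity-++ α cols rows ⟩
      parity α cols xor parity α rows      ≡⟨ Boolₚ.xor-comm (parity α cols) (parity α rows) ⟩
      parity α rows xor parity α cols      ≡⟨ parity-++ α rows cols ⟨
      parity α (boundary d p q a b)        ∎
      where open ≡-Reasoning

  boundary-cell : ∀ p q → boundary true p q 1 1 ≡ cell p q
  boundary-cell p q = cong₂ _++_
    (trans (Listₚ.++-identityʳ _) (cong (λ q′ → before true p q ++ before true p q′) (+-comm q 1)))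
    (trans (Listₚ.++-identityʳ _) (cong (λ p′ → before false q p ++ before false q p′) (+-comm p 1)))

  cell-solved : ∀ {n p q} → p < m → q < m → Solved n true p q 1 1
  cell-solved {n} {p} {q} p<m q<m {α} y₀-true odd rewrite boundary-cell p q =
    weaken z≤n id (axiom-derivable (cell-axiom {p} {q} {α} p<m q<m (cong₂ _∧_ y₀-true odd))
      (≤-trans (width-blocking-≤ {β = α} {y₀ ∷ cell p q}) (begin
        suc (length (cell p q))  ≤⟨ s≤s (length-cell p q) ⟩
        9                        ≤⟨ m≤m+n 9 2 ⟩
        11                       ≤⟨ m≤m*n 11 m ⟩
        11 * m                   ∎)))
    where open ≤-Reasoning

  module Split (d : Bool) (p q a₁ a₂ b : ℕ) where

    f g g₁ g₂ cut : ℕ → List (Fin V)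
    f i   = before d i q ++ before d i (q + b)
    g j   = before (not d) j p ++ before (not d) j (p + (a₁ + a₂))
    g₁ j  = before (not d) j p ++ before (not d) j (p + a₁)
    g₂ j  = before (not d) j (p + a₁) ++ before (not d) j (p + (a₁ + a₂))
    cut j = before (not d) j (p + a₁)

    whole part₁ part₂ : List (Fin V)
    whole = segment f p (a₁ + a₂) ++ segment g q b
    part₁ = segment f p a₁ ++ segment g₁ q b
    part₂ = segment f (p + a₁) a₂ ++ segment g₂ q b

    part₂-boundary : boundary d (p + a₁) q a₂ b ≡ part₂
    part₂-boundary = cong (λ e → segment f (p + a₁) a₂ ++ segment
        (λ j → before (not d) j (p + a₁) ++ before (not d) j e) q b)
                          (+-assoc p a₁ a₂)

    -- The cut belongs to the boundaries of both parts and cancels modulo 2.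
    parity-split : ∀ α → parity α part₁ xor parity α part₂ ≡ parity α whole
    parity-split α = begin
      parity α part₁ xor parity α part₂
        ≡⟨ cong₂ _xor_ (parity-++ α (segment f p a₁) _) (parity-++ α (segment f (p + a₁) a₂) _) ⟩
      (f₁ xor c₁) xor (f₂ xor c₂)
        ≡⟨ solve 4 (λ a b c d → (a :+ b) :+ (c :+ d) := (a :+ c) :+ (b :+ d)) refl f₁ c₁ f₂ c₂ ⟩
      (f₁ xor f₂) xor (c₁ xor c₂)
        ≡⟨ cong₂ _xor_ (trans (cong (parity α) (segment-+ f p a₁ a₂)) (parity-++ α (segment f p a₁) _))
                       (sym (parity-segment {f = g₁} {g₂} {g} α telescope q b)) ⟨
      parity α (segment f p (a₁ + a₂)) xor parity α (segment g q b)
        ≡⟨ parity-++ α (segment f p (a₁ + a₂)) (segment g q b) ⟨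
      parity α whole ∎
      where
      open ≡-Reasoning
      open xor-∧-Solver
      f₁ = parity α (segment f p a₁)
      f₂ = parity α (segment f (p + a₁) a₂)
      c₁ = parity α (segment g₁ q b)
      c₂ = parity α (segment g₂ q b)

      telescope : ∀ j → parity α (g₁ j) xor parity α (g₂ j) ≡ parity α (g j)
      telescope j = begin
        parity α (x ++ y) xor parity α (y ++ z)                        ≡⟨ cong₂ _xor_ (parity-++ α x y)
            (parity-++ α y z) ⟩
        (parity α x xor parity α y) xor (parity α y xor parity α z)
          ≡⟨ solve 3 (λ x y z → (x :+ y) :+ (y :+ z) := x :+ z) refl (parity α x) (parity α y) (parity α z) ⟩
        parity α x xor parity α z                                      ≡⟨ parity-++ α x z ⟨
        parity α (x ++ z)                                              ∎
        where
        x = before (not d) j p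
        y = before (not d) j (p + a₁)
        z = before (not d) j (p + (a₁ + a₂))

    private
      C = segment cut q b

      from-cut : C ⊆ C ++ y₀ ∷ whole
      from-cut = ∈-++⁺ˡ

      from-whole : whole ⊆ C ++ y₀ ∷ whole
      from-whole x∈ = ∈-++⁺ʳ C (there x∈)

      from-f : ∀ {x} → x ∈ segment f p a₁ ++ segment f (p + a₁) a₂ → x ∈ C ++ y₀ ∷ whole
      from-f {x} x∈ = from-whole (∈-++⁺ˡ (subst (x ∈_) (sym (segment-+ f p a₁ a₂)) x∈))

      from-g : {h : ℕ → List (Fin V)} → (∀ j → h j ⊆ g j) → segment h q b ⊆ C ++ y₀ ∷ whole
      from-g h⊆g x∈ = from-whole (∈-++⁺ʳ (segment f p (a₁ + a₂)) (segment-mono h⊆g q b x∈))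

    part₁-⊆ : y₀ ∷ part₁ ⊆ C ++ y₀ ∷ whole
    part₁-⊆ (here e) = ∈-++⁺ʳ C (here e)
    part₁-⊆ (there x∈) with ∈-++⁻ (segment f p a₁) x∈
    ... | inj₁ x∈f = from-f (∈-++⁺ˡ x∈f)
    ... | inj₂ x∈g with ∈-++⁻ (segment (λ j → before (not d) j p) q b) (segment-∪ q b x∈g)
    ...   | inj₁ x∈p = from-g {λ j → before (not d) j p} (λ j → ∈-++⁺ˡ) x∈p
    ...   | inj₂ x∈c = from-cut x∈c

    part₂-⊆ : y₀ ∷ part₂ ⊆ C ++ y₀ ∷ whole
    part₂-⊆ (here e) = ∈-++⁺ʳ C (here e)
    part₂-⊆ (there x∈) with ∈-++⁻ (segment f (p + a₁) a₂) x∈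
    ... | inj₁ x∈f = from-f (∈-++⁺ʳ (segment f p a₁) x∈f)
    ... | inj₂ x∈g with ∈-++⁻ C (segment-∪ q b x∈g)
    ...   | inj₁ x∈c = from-cut x∈c
    ...   | inj₂ x∈e = from-g {λ j → before (not d) j (p + (a₁ + a₂))} (λ j → ∈-++⁺ʳ (before (not d) j p)) x∈e

    length-cut : length C ≤ b * 2
    length-cut = length-segment (λ j → length-before (not d) j (p + a₁)) q b

    length-whole : length whole ≤ (a₁ + a₂) * 4 + b * 4
    length-whole = ≤-trans (≤-reflexive (Listₚ.length-++ (segment f p (a₁ + a₂)))) (+-mono-≤
      (length-segment (λ i → length-before-++ d i q d i (q + b)) p (a₁ + a₂))
      (length-segment (λ j → length-before-++ (not d) j p (not d) j (p + (a₁ + a₂))) q b))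

    -- The corner of the second part is never the origin.
    split-charge : 1 ≤ a₁ → charge p q xor charge (p + a₁) q ≡ charge p q
    split-charge (s≤s {n = n} _) = trans (cong (λ r → charge p q xor charge r q) (+-suc p n)) (Boolₚ.xor-identityʳ _)

    -- Once the cut is queried, both parts have known boundary values, and their defects add up to
    -- that of the whole, which is odd. So one part is odd, and its tree finishes.
    split-solved : 1 ≤ a₁ → a₁ ≤ a₂ → a₂ ≤ 2 * a₁ → b ≤ a₁ + a₂ → p + (a₁ + a₂) ≤ m → q + b ≤ m →
                   Solved (6 * (a₁ + b)) d p q a₁ b → Solved (6 * (a₂ + b)) d (p + a₁) q a₂ b →
                   Solved (6 * (a₁ + a₂ + b)) d p q (a₁ + a₂) b
    split-solved 1≤a₁ a₁≤a₂ a₂≤2a₁ b≤a pa≤m qb≤m solved₁ solved₂ {α} y₀-true odd =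
      weaken depth id (query C {S = y₀ ∷ whole} {α} width-bound inner)
      where
      inner : ∀ {β} → (∀ {y} → y ∈ y₀ ∷ whole → β y ≡ α y) →
              Derivable (6 * (a₂ + b)) (blocking β (C ++ y₀ ∷ whole))
      inner {β} agree = choose (xor-true total)
        where
        open ≡-Reasoning
        open xor-∧-Solver
        total : (parity β part₁ xor charge p q) xor (parity β part₂ xor charge (p + a₁) q) ≡ true
        total = begin
          (parity β part₁ xor charge p q) xor (parity β part₂ xor charge (p + a₁) q)
            ≡⟨ solve 4 (λ a b c d → (a :+ b) :+ (c :+ d) := (a :+ c) :+ (b :+ d)) refl
                 (parity β part₁) (charge p q) (parity β part₂) (charge (p + a₁) q) ⟩
          (parity β part₁ xor parity β part₂) xor (charge p q xor charge (p + a₁) q)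
            ≡⟨ cong₂ _xor_ (parity-split β) (split-charge 1≤a₁) ⟩
          parity β whole xor charge p q
            ≡⟨ cong (_xor charge p q) (parity-cong whole (agree ∘ there)) ⟩
          parity α whole xor charge p q
            ≡⟨ odd ⟩
          true ∎

        choose : parity β part₁ xor charge p q ≡ true ⊎ parity β part₂ xor charge (p + a₁) q ≡ true →
                 Derivable (6 * (a₂ + b)) (blocking β (C ++ y₀ ∷ whole))
        choose (inj₁ odd₁) = weaken (*-monoʳ-≤ 6 (+-monoˡ-≤ b a₁≤a₂))
          (blocking-mono {β = β} {β} {y₀ ∷ part₁} part₁-⊆ (λ _ → refl))
          (solved₁ (trans (agree (here refl)) y₀-true) odd₁)
        choose (inj₂ odd₂) = weaken ≤-refl
          (blocking-mono {β = β} {β} {y₀ ∷ part₂} part₂-⊆ (λ _ → refl))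
          (subst (λ S → Derivable (6 * (a₂ + b)) (blocking β (y₀ ∷ S))) part₂-boundary
            (solved₂ (trans (agree (here refl)) y₀-true)
              (subst (λ S → parity β S xor charge (p + a₁) q ≡ true) (sym part₂-boundary) odd₂)))

      open ≤-Reasoning
      open +-*-Solver

      -- As `b ≤ a₁ + a₂ ≤ 3 * a₁`, the cut costs at most `6 * a₁` queries, exactly what passing to
      -- the larger part saves.
      depth : length C + 6 * (a₂ + b) ≤ 6 * (a₁ + a₂ + b)
      depth = begin
        length C + 6 * (a₂ + b)      ≤⟨ +-monoˡ-≤ _ length-cut ⟩
        b * 2 + 6 * (a₂ + b)         ≤⟨ +-monoˡ-≤ _ (*-monoˡ-≤ 2 (≤-trans b≤a (+-monoʳ-≤ a₁ a₂≤2a₁))) ⟩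
        (a₁ + 2 * a₁) * 2 + 6 * (a₂ + b)
          ≡⟨ solve 3 (λ a₁ a₂ b → (a₁ :+ con 2 :* a₁) :* con 2 :+ con 6 :* (a₂ :+ b) := con 6 :*
              (a₁ :+ a₂ :+ b)) refl a₁ a₂ b ⟩
        6 * (a₁ + a₂ + b)            ∎

      width-bound : length C + length (y₀ ∷ whole) ≤ w
      width-bound = begin
        length C + suc (length whole)            ≤⟨ +-mono-≤ length-cut (s≤s length-whole) ⟩
        b * 2 + suc ((a₁ + a₂) * 4 + b * 4)      ≤⟨ +-mono-≤ (*-monoˡ-≤ 2 b≤m) (+-mono-≤ {1} {m} (s≤s z≤n)
                                                      (+-mono-≤ (*-monoˡ-≤ 4 a≤m) (*-monoˡ-≤ 4 b≤m))) ⟩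
        m * 2 + (m + (m * 4 + m * 4))
          ≡⟨ solve 1 (λ m → m :* con 2 :+ (m :+ (m :* con 4 :+ m :* con 4)) := con 11 :* m) refl m ⟩
        11 * m                                   ∎
        where
        b≤m : b ≤ m
        b≤m = ≤-trans (m≤n+m b q) qb≤m
        a≤m : a₁ + a₂ ≤ m
        a≤m = ≤-trans (m≤n+m _ p) pa≤m

  -- Halving always the longer side of the rectangle keeps the
  -- number of queries linear in the side lengths.
  mutual
    solved : ∀ t d p q a b → a + b ≤ t → 1 ≤ a → 1 ≤ b → p + a ≤ m → q + b ≤ m → Solved (6 * (a + b)) d p q a b
    solved t d p q a b a+b≤t 1≤a 1≤b pa≤m qb≤m with b ≤? a
    ... | yes b≤a = solved-long t d p q a b a+b≤t b≤a 1≤a 1≤b pa≤m qb≤m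
    ... | no b≰a  = flip-solved {6 * (a + b)} {d} {p} {q} {a} {b}
      (subst (λ n → Solved (6 * n) (not d) q p b a) (+-comm b a)
        (solved-long t (not d) q p b a (subst (_≤ t) (+-comm a b) a+b≤t) (<⇒≤ (≰⇒> b≰a)) 1≤b 1≤a qb≤m pa≤m))

    solved-long : ∀ t d p q a b → a + b ≤ t → b ≤ a → 1 ≤ a → 1 ≤ b → p + a ≤ m → q + b ≤ m →
                  Solved (6 * (a + b)) d p q a b
    solved-long t true  p q 1 1 _ _ _ _ p≤ q≤ = cell-solved (subst (_≤ m) (+-comm p 1) p≤)
        (subst (_≤ m) (+-comm q 1) q≤)
    solved-long t false p q 1 1 _ _ _ _ p≤ q≤ = flip-solved {12} {false} {p} {q} {1} {1}
      (cell-solved (subst (_≤ m) (+-comm q 1) q≤) (subst (_≤ m) (+-comm p 1) p≤))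
    solved-long t d p q 1 (suc (suc b)) _ (s≤s ()) _ _ _ _
    solved-long (suc t) d p q a@(suc (suc _)) b (s≤s a+b≤t) b≤a 1≤a 1≤b pa≤m qb≤m
      with a₁ , a₂ , a≡ , 1≤a₁ , a₁≤a₂ , a₂≤2a₁ ← halve a (s≤s (s≤s z≤n)) =
      subst (λ a → Solved (6 * (a + b)) d p q a b) (sym a≡)
        (Split.split-solved d p q a₁ a₂ b 1≤a₁ a₁≤a₂ a₂≤2a₁ (subst (b ≤_) a≡ b≤a) pa≤m′ qb≤m
          (solved t d p q a₁ b (smaller a₁ (≤-trans (+-monoˡ-≤ a₁ 1≤a₂) (≤-reflexive (+-comm a₂ a₁)))) 1≤a₁ 1≤b
            (≤-trans (+-monoʳ-≤ p (m≤m+n a₁ a₂)) pa≤m′) qb≤m)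
          (solved t d (p + a₁) q a₂ b (smaller a₂ (+-monoˡ-≤ a₂ 1≤a₁)) 1≤a₂ 1≤b
            (subst (_≤ m) (sym (+-assoc p a₁ a₂)) pa≤m′) qb≤m))
      where
      1≤a₂ = ≤-trans 1≤a₁ a₁≤a₂
      pa≤m′ : p + (a₁ + a₂) ≤ m
      pa≤m′ = subst (λ a → p + a ≤ m) a≡ pa≤m
      smaller : ∀ a′ → suc a′ ≤ a₁ + a₂ → a′ + b ≤ t
      smaller a′ a′<a = ≤-trans (+-monoˡ-≤ b (≤-pred (subst (suc a′ ≤_) (sym a≡) a′<a))) a+b≤t

  edge-outside : ∀ d a → edge d a M ≡ []
  edge-outside d a with a <? m | M <? M
  ... | yes _ | no _    = refl
  ... | no _  | _       = refl
  ... | yes _ | yes M<M = contradiction M<M (<-irrefl refl)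

  boundary-all : boundary true 0 0 m m ≡ []
  boundary-all = cong₂ _++_ (segment-[] (edge-outside true) 0 m) (segment-[] (edge-outside false) 0 m)

  -- The whole grid has no boundary but odd charge, so the clause of its tree mentions only `y₀`.
  negUnit-derivable : Derivable (6 * (m + m)) (negUnit y₀)
  negUnit-derivable = subst (λ S → Derivable (6 * (m + m)) (blocking (const true) (y₀ ∷ S))) boundary-all
    (solved (m + m) true 0 0 m m ≤-refl (s≤s z≤n) (s≤s z≤n) ≤-refl ≤-refl {const true} refl
      (cong (λ S → parity (const true) S xor true) boundary-all))

-- The refutation in minimal space and the short refutation.

len-≤ : {F : CNF} (π : Refutation F) (𝕌 : ClauseSet (numVars F)) → All (_⊆ 𝕌) (configurations π) → len π ≤ length 𝕌
len-≤ {F} π 𝕌 sub = length-⊆ (distinct-unique (concat (configurations π)))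
  (λ C∈ → go (configurations π) sub (∈-deduplicate⁻ _≟ᶜ_ (concat (configurations π)) C∈))
  where
  go : ∀ ℂs → All (_⊆ 𝕌) ℂs → concat ℂs ⊆ 𝕌
  go (ℂ ∷ ℂs) (h ∷ hs) C∈ with ∈-++⁻ ℂ C∈
  ... | inj₁ p = h p
  ... | inj₂ p = go ℂs hs p

module Refutations (M K : ℕ) where
  open Formula M K

  private
    W Z : Clause V
    W = posClause (y₀ ∷ ys)
    Z = posClause zs

    z₀ : Fin V
    z₀ = zvar zero

    two : ∀ (C D : Clause V) {c d} → width C ≤ c → width D ≤ d → totalWidth (C ∷ D ∷ []) ≤ c + d
    two C D {c} {d} C≤ D≤ = ≤-trans (totalWidth-≤-sum (C ∷ D ∷ []))
      (+-mono-≤ C≤ (subst (_≤ d) (sym (+-identityʳ (width D))) D≤))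

    W≤ : width W ≤ suc K
    W≤ = subst (width W ≤_) length-y₀∷ys (width-blocking-≤ {β = const false} {y₀ ∷ ys})

    Z≤ : width Z ≤ 2 + K
    Z≤ = subst (width Z ≤_) length-zs (width-blocking-≤ {β = const false} {zs})

  -- The tree is run from the empty configuration, and the wide clause is downloaded only when
  -- nothing but `negUnit y₀` is left. The hypothesis is the space `w * (2 + d)` of a tree of depth
  -- `d = 6 * (m + m)`.
  small-refutation : 11 * m * (2 + 6 * (m + m)) ≤ 2 * suc K → Σ[ π ∈ Refutation formula ] varSp π ≤ 2 * suc K
  small-refutation enough = let π , good = steps z≤n (here! (finish negUnit-derivable)) in π , varSp-≤ π good
    where
    open UpperBound M K
    open DecisionTree formula w s

    Q : ClauseSet V → Set
    Q ℂ = totalWidth ℂ ≤ s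

    Q-mono : ∀ {𝔸 𝔹} → 𝔹 ⊆ 𝔸 → Q 𝔸 → Q 𝔹
    Q-mono {𝔸} {𝔹} sub = ≤-trans (totalWidth-mono {𝔹 = 𝔹} {𝔸} sub)

    open Bounded formula Q Q-mono

    continue : Reaches [] [ negUnit y₀ ] → Reaches [] [ 𝟘 ]
    continue r = r ▻ downloads (here refl) (≤-trans (two W (negUnit y₀) W≤ (width-negUnit y₀))
        (+-monoʳ-≤ (suc K) (s≤s z≤n)))
      ▻ cascade Q Q-mono y₀ ys y₀∷ys-unique y-axiom (λ tw _ → ≤-trans tw (*-monoʳ-≤ 2 (≤-reflexive length-y₀∷ys)))

    finish : Derivable (6 * (m + m)) (negUnit y₀) → Reaches [] [ 𝟘 ]
    finish (derivable C C⊆ reach) with lookup C y₀ in eq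
    ... | just b  = continue (subst (λ C → Reaches [] [ C ]) (literal-ext C⊆ unit⊆) (reach [] enough))
      where
      unit⊆ : negUnit y₀ ⊆ₗ C
      unit⊆ {y} e with ∈-blocking⁻ {β = const true} {[ y₀ ]} e
      ... | here refl , refl = trans eq (cong just (proj₂ (∈-blocking⁻ {β = const true} {[ y₀ ]} (C⊆ eq))))
    -- `Derivable` does not exclude that the part is empty; the refutation is then complete.
    ... | nothing = subst (λ C → Reaches [] [ C ]) (literal-ext C-empty
        (λ {y} e → contradiction e (∉-𝟘 {y = y}))) (reach [] enough)
      where
      C-empty : C ⊆ₗ 𝟘
      C-empty {y} e with proj₁ (∈-blocking⁻ {β = const true} {[ y₀ ]} (C⊆ {y} e))
      ... | here refl with () ← trans (sym eq) e

  -- Only the clauses on `zs` are used. Keeping every configuration inside `cascadeClauses zs`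
  -- bounds the number of distinct clauses by the length of that list.
  short-refutation : Σ[ π ∈ Refutation formula ] (varSp π ≤ 2 * (2 + K) × len π ≤ suc (2 * (2 + K)))
  short-refutation = π , varSp-≤ π (All.map proj₁ good) , len≤
    where
    Q : ClauseSet V → Set
    Q ℂ = totalWidth ℂ ≤ 2 * (2 + K) × ℂ ⊆ cascadeClauses zs

    Q-mono : ∀ {𝔸 𝔹} → 𝔹 ⊆ 𝔸 → Q 𝔸 → Q 𝔹
    Q-mono {𝔸} {𝔹} sub (tw , univ) = ≤-trans (totalWidth-mono {𝔹 = 𝔹} {𝔸} sub) tw , univ ∘ sub

    open Bounded formula Q Q-mono

    start : Q (Z ∷ negUnit z₀ ∷ [])
    start = ≤-trans (two Z (negUnit z₀) Z≤ (width-negUnit z₀)) (+-monoʳ-≤ (2 + K) (s≤s z≤n)) ,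
            λ { (here e) → here e ; (there (here e)) → there (here e) }

    refute : Reaches [] [ 𝟘 ]
    refute = downloads (z-axiom (here refl)) (Q-mono there start)
      ▻ downloads (there (here refl)) start
      ▻ cascade Q Q-mono z₀ (map zvar (tabulate suc)) zs-unique (z-axiom ∘ there)
          (λ tw sub → ≤-trans tw (*-monoʳ-≤ 2 (≤-reflexive length-zs)) , sub)

    refutation = steps (z≤n , λ ()) (here! refute)
    π = proj₁ refutation
    good = proj₂ refutation

    len≤ : len π ≤ suc (2 * (2 + K))
    len≤ = begin
      len π                             ≤⟨ len-≤ π (cascadeClauses zs) (All.map proj₂ good) ⟩
      length (cascadeClauses zs)        ≡⟨ length-cascadeClauses zs ⟩
      suc (2 * length zs)               ≡⟨ cong (λ n → suc (2 * n)) length-zs ⟩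
      suc (2 * (2 + K))                 ∎
      where open ≤-Reasoning

-- Lower bounds on space and length.

firstJust : ∀ {n} → (Fin n → Maybe A) → Maybe A
firstJust {n = zero}  f = nothing
firstJust {n = suc n} f = f zero <∣> firstJust (f ∘ suc)

firstJust-just : ∀ {n} (f : Fin n → Maybe A) {a} → firstJust f ≡ just a → ∃[ i ] f i ≡ just a
firstJust-just {n = suc n} f e with f zero in eq
... | just _  = zero , trans eq e
... | nothing = let i , e′ = firstJust-just (f ∘ suc) e in suc i , e′

firstJust-nothing : ∀ {n} (f : Fin n → Maybe A) → firstJust f ≡ nothing → ∀ i → f i ≡ nothing
firstJust-nothing {n = suc n} f e i with f zero in eq
firstJust-nothing {n = suc n} f e zero    | nothing = eq
firstJust-nothing {n = suc n} f e (suc i) | nothing = firstJust-nothing (f ∘ suc) e i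

<ᵇ-suc : ∀ p u → (p <ᵇ suc u) xor (p <ᵇ u) ≡ (p ≡ᵇ u)
<ᵇ-suc zero    zero    = refl
<ᵇ-suc zero    (suc u) = refl
<ᵇ-suc (suc p) zero    = refl
<ᵇ-suc (suc p) (suc u) = <ᵇ-suc p u

≮⇒<ᵇ : ∀ {p u} → ¬ p < u → (p <ᵇ u) ≡ false
≮⇒<ᵇ {p} {u} p≮u with p <ᵇ u in eq
... | false = refl
... | true  = contradiction (<ᵇ⇒< p u (subst T (sym eq) tt)) p≮u

≢⇒≡ᵇ : ∀ {p u} → p ≢ u → (p ≡ᵇ u) ≡ false
≢⇒≡ᵇ {p} {u} p≢u with p ≡ᵇ u in eq
... | false = refl
... | true  = contradiction (≡ᵇ⇒≡ p u (subst T (sym eq) tt)) p≢u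

≡ᵇ-refl : ∀ p → (p ≡ᵇ p) ≡ true
≡ᵇ-refl zero    = refl
≡ᵇ-refl (suc p) = ≡ᵇ-refl p

totalWidth-≤-varSp : {F : CNF} (π : Refutation F) → All (λ ℂ → totalWidth ℂ ≤ varSp π) (configurations π)
totalWidth-≤-varSp {F} π = go (configurations π)
  where
  go : ∀ ℂs → All (λ ℂ → totalWidth {numVars F} ℂ ≤ foldr _⊔_ 0 (map totalWidth ℂs)) ℂs
  go []       = []
  go (ℂ ∷ ℂs) = m≤m⊔n _ _ ∷ All.map (λ h → ≤-trans h (m≤n⊔m (totalWidth ℂ) _)) (go ℂs)

posClause-positive : (xs : List (Fin N)) {x : Fin N} → ¬ (x , false) ∈ₗ posClause xs
posClause-positive xs e with ∈-blocking⁻ {β = const false} {xs} e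
... | _ , ()

𝟘≢posClause : (x : Fin N) (xs : List (Fin N)) → 𝟘 ≢ posClause (x ∷ xs)
𝟘≢posClause x xs e = ∉-𝟘 {y = x} (subst (λ C → (x , true) ∈ₗ C) (sym e)
                                          (∈-blocking⁺ {β = const false} {x ∷ xs} (here refl)))

literal⇒⊨ : {α : Assignment N} {C : Clause N} {x : Fin N} {b : Bool} → (x , b) ∈ₗ C → α x ≡ b → α ⊨ C
literal⇒⊨ {C = C} {x} e αx = x , trans e (cong just (sym αx))

negUnit-⊨ : {α : Assignment N} {x : Fin N} → α x ≡ false → α ⊨ negUnit x
negUnit-⊨ {x = x} = literal⇒⊨ {C = negUnit x} (∈-blocking⁺ {β = const true} {[ x ]} (here refl))

module LowerBound (M K : ℕ) where
  open Formula M K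

  private
    W Z : Clause V
    W = posClause (y₀ ∷ ys)
    Z = posClause zs

    width-W : width W ≡ suc K
    width-W = trans (width-blocking {β = const false} y₀∷ys-unique) length-y₀∷ys

    width-Z : width Z ≡ 2 + K
    width-Z = trans (width-blocking {β = const false} zs-unique) length-zs

    𝟘≢Z : 𝟘 ≢ Z
    𝟘≢Z = 𝟘≢posClause (zvar zero) (map zvar (tabulate suc))

  violates⇒y₀ : ∀ {p q β} → violates p q β ≡ true → β y₀ ≡ true
  violates⇒y₀ {β = β} bad with β y₀
  ... | true = refl

  violates⇒odd : ∀ {p q β} → violates p q β ≡ true → parity β (cell p q) xor charge p q ≡ true
  violates⇒odd {β = β} bad with β y₀
  ... | true = bad

  -- In less space `wide-premise` keeps `W` and `Z` from being premises. All other axioms hold under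
  -- the all-false assignment, the cell axioms through their literal on `y₀`, and resolution
  -- preserves this.
  space-bound : (π : Refutation formula) → 2 * suc K ≤ varSp π
  space-bound π with 2 * suc K ≤? varSp π
  ... | yes h = h
  ... | no h  = contradiction (invariant Good I axiom inference′ π good (λ ()) (here refl))
    λ { (inj₁ e) → 𝟘≢posClause y₀ ys e ; (inj₂ (inj₁ e)) → 𝟘≢Z e ; (inj₂ (inj₂ s)) → 𝟘-unsatisfied s }
    where
    Good : ClauseSet V → Set
    Good ℂ = totalWidth ℂ < 2 * suc K

    I : Clause V → Set
    I C = C ≡ W ⊎ C ≡ Z ⊎ (const false ⊨ C)

    good : All Good (configurations π)
    good = All.map (λ h′ → ≤-trans (s≤s h′) (≰⇒> h)) (totalWidth-≤-varSp π)

    axiom : ∀ {C} → C ∈ clauses formula → I C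
    axiom C∈ with axiom⁻ C∈
    ... | is-W e         = inj₁ e
    ... | is-Z e         = inj₂ (inj₁ e)
    ... | is-y _ refl    = inj₂ (inj₂ (negUnit-⊨ refl))
    ... | is-z _ refl    = inj₂ (inj₂ (negUnit-⊨ refl))
    ... | is-cell {p} {q} {β} _ _ bad refl = inj₂ (inj₂ (literal⇒⊨ {C = blocking β (y₀ ∷ cell p q)}
            (∈-blocking⁺ {β = β} {y₀ ∷ cell p q} (here refl)) (cong not (sym (violates⇒y₀ {p} {q} {β} bad)))))

    inference′ : ∀ {ℂ P P′ R} → Good ℂ → P ∈ ℂ → P′ ∈ ℂ → R ∈ ℂ → Resolvent P P′ R → I P → I P′ → I R
    inference′ small P∈ P′∈ R∈ r iP iP′ = inj₂ (inj₂ (resolvent-sound r (sat iP (proj₁ ≢W) (proj₁ ≢Z))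
        (sat iP′ (proj₂ ≢W) (proj₂ ≢Z))))
      where
      ≢W = wide-premise {W = W} (posClause-positive (y₀ ∷ ys))
          (≤-trans small (*-monoʳ-≤ 2 (≤-reflexive (sym width-W)))) P∈ P′∈ R∈ r
      ≢Z = wide-premise {W = Z} (posClause-positive zs)
             (≤-trans small (*-monoʳ-≤ 2 (≤-trans (n≤1+n _) (≤-reflexive (sym width-Z))))) P∈ P′∈ R∈ r
      sat : ∀ {C} → I C → C ≢ W → C ≢ Z → const false ⊨ C
      sat (inj₁ e)        ≢W _  = contradiction e ≢W
      sat (inj₂ (inj₁ e)) _  ≢Z = contradiction e ≢Z
      sat (inj₂ (inj₂ s)) _  _  = s

  line-injective : ∀ {d d′ r r′} → line d r ≡ line d′ r′ → d ≡ d′ × r ≡ r′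
  line-injective {true}  {true}  {r} {r′} e = refl , Finₚ.↑ˡ-injective m r r′ e
  line-injective {false} {false} {r} {r′} e = refl , Finₚ.↑ʳ-injective m r r′ e
  line-injective {true}  {false} {r} {r′} e
    with () ← trans (sym (Finₚ.splitAt-↑ˡ m r m)) (trans (cong (Fin.splitAt m) e) (Finₚ.splitAt-↑ʳ m m r′))
  line-injective {false} {true}  {r} {r′} e
    with () ← trans (sym (Finₚ.splitAt-↑ˡ m r′ m)) (trans (cong (Fin.splitAt m) (sym e)) (Finₚ.splitAt-↑ʳ m m r))

  lineOf : Fin V → Maybe Line
  lineOf x = [ just ∘ proj₁ ∘ proj₁ , const nothing ]′ (decode x)

  lineOf-tvar : ∀ ℓ j i → lineOf (tvar ℓ j i) ≡ just ℓ
  lineOf-tvar ℓ j i = cong [ just ∘ proj₁ ∘ proj₁ , const nothing ]′ (decode-encode (inj₁ ((ℓ , j) , i)))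

  touchAt : Clause V → Line → Fin M → Maybe Option
  touchAt C ℓ j = Maybe.map (true ,_) (lookup C (tvar ℓ j true)) <∣> Maybe.map (false ,_) (lookup C (tvar ℓ j false))

  -- For each touched line, the option read off one literal of `C` on it. A restriction choosing
  -- this option satisfies that literal and with it `C`.
  profile : Clause V → Vec (Maybe Option) (m + m)
  profile C = Vec.tabulate λ ℓ → firstJust (touchAt C ℓ)

  touched : Clause V → ℕ
  touched C = length (support (profile C))

  Untouched : Line → Clause V → Set
  Untouched ℓ C = ∀ j i → lookup C (tvar ℓ j i) ≡ nothing

  profile-just : ∀ {C ℓ o} → lookup (profile C) ℓ ≡ just o → ∃[ j ] (tvar ℓ j (proj₁ o) , proj₂ o) ∈ₗ C
  profile-just {C} {ℓ} {o} e with firstJust-just (touchAt C ℓ)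
      (trans (sym (lookup∘tabulate (firstJust ∘ touchAt C) ℓ)) e)
  ... | j , e′ = j , go e′
    where
    go : touchAt C ℓ j ≡ just o → (tvar ℓ j (proj₁ o) , proj₂ o) ∈ₗ C
    go e with lookup C (tvar ℓ j true) in eq | lookup C (tvar ℓ j false) in eq′
    go refl | just _  | _      = eq
    go refl | nothing | just _ = eq′

  profile-nothing : ∀ {C ℓ} → lookup (profile C) ℓ ≡ nothing → Untouched ℓ C
  profile-nothing {C} {ℓ} e j i = go i (firstJust-nothing (touchAt C ℓ)
      (trans (sym (lookup∘tabulate (firstJust ∘ touchAt C) ℓ)) e) j)
    where
    go : ∀ i → touchAt C ℓ j ≡ nothing → lookup C (tvar ℓ j i) ≡ nothing
    go i e with lookup C (tvar ℓ j true) in eq | lookup C (tvar ℓ j false) in eq′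
    go true  _ | nothing | nothing = eq
    go false _ | nothing | nothing = eq′

  -- Besides `r` there are `M` lines in direction `d`, more than `C` touches altogether.
  spare-line : ∀ d r {C} → touched C < M → ∃[ r′ ] (r′ ≢ r × Untouched (line d r′) C)
  spare-line d r {C} few with Finₚ.any? (λ k → free? (line d (Fin.punchIn r k)))
    where
    free? : ∀ ℓ → Dec (lookup (profile C) ℓ ≡ nothing)
    free? ℓ = Maybeₚ.≡-dec (≡-dec Boolₚ._≟_ Boolₚ._≟_) _ nothing
  ... | yes (k , free) = Fin.punchIn r k , Finₚ.punchInᵢ≢i r k , profile-nothing {C} {line d (Fin.punchIn r k)} free
  ... | no none = contradiction few (≤⇒≯ (subst (_≤ touched C)
          (trans (length-map other (allFin M)) (Listₚ.length-tabulate id))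
          (length-⊆ (Unique.map⁺ (λ e → Finₚ.punchIn-injective r _ _ (proj₂ (line-injective {d} {d} e)))
              (Unique.allFin⁺ M)) all-touched)))
    where
    other : Fin M → Line
    other k = line d (Fin.punchIn r k)

    all-touched : map other (allFin M) ⊆ support (profile C)
    all-touched ℓ∈ with ∈-map⁻ other ℓ∈
    ... | k , _ , refl with lookup (profile C) (other k) in eq
    ...   | just _  = ∈-support⁺ (profile C) eq
    ...   | nothing = contradiction (k , eq) none

  at : Fin m → Fin m → ℕ → ℕ → Bool
  at r c p q = (p ≡ᵇ toℕ r) ∧ (q ≡ᵇ toℕ c)

  -- The option (i , b) of a line fixes the i-variable of each of its edges to
  -- b; the values of the edges stay free.
  record Critical (ρ : Vec Option (m + m)) (r c : Fin m) (α : Assignment V) : Set where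
    field
      restricted : ∀ ℓ j → α (tvar ℓ j (proj₁ (lookup ρ ℓ))) ≡ proj₂ (lookup ρ ℓ)
      y₀-true    : α y₀ ≡ true
      y-false    : ∀ {x} → x ∈ ys → α x ≡ false
      z-false    : ∀ {x} → x ∈ zs → α x ≡ false
      one-defect : ∀ p q → parity α (cell p q) ≡ charge p q xor at r c p q

  parity-cell : ∀ α p q → parity α (cell p q) ≡
    (parity α (before true p q) xor parity α (before true p (suc q))) xor
    (parity α (before false q p) xor parity α (before false q (suc p)))
  parity-cell α p q = trans (parity-++ α (before true p q ++ before true p (suc q))
      (before false q p ++ before false q (suc p)))
    (cong₂ _xor_ (parity-++ α (before true p q) _) (parity-++ α (before false q p) _))

  module _ (ρ : Vec Option (m + m)) where

    initial : Assignment V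
    initial x = value (decode x)
      where
      value : Variable → Bool
      value (inj₁ ((ℓ , _) , _))    = proj₂ (lookup ρ ℓ)
      value (inj₂ (inj₁ zero))      = true
      value (inj₂ (inj₁ (suc _)))   = false
      value (inj₂ (inj₂ _))         = false

    -- Both copies of an edge get the same value, so every cell is even, and only the charged origin
    -- is violated.
    initial-critical : Critical ρ zero zero initial
    initial-critical = record
      { restricted = λ ℓ j → initial-tvar ℓ j _
      ; y₀-true    = cong-value (inj₂ (inj₁ zero))
      ; y-false    = λ x∈ → case ∈-map⁻ yvar x∈ of λ { (i , i∈ , refl) → case ∈-tabulate⁻ {f = suc} i∈ of
                       λ { (k , refl) → cong-value (inj₂ (inj₁ (suc k))) } }
      ; z-false    = λ x∈ → case ∈-map⁻ zvar x∈ of λ { (i , _ , refl) → cong-value (inj₂ (inj₂ i)) }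
      ; one-defect = λ p q → trans (parity-cell initial p q)
          (trans (cong₂ _xor_ (cong₂ _xor_ (even-before true p q) (even-before true p (suc q)))
                              (cong₂ _xor_ (even-before false q p) (even-before false q (suc p))))
                 (sym (Boolₚ.xor-same (charge p q))))
      }
      where
      cong-value : ∀ v → initial (encode v) ≡ _
      cong-value v rewrite decode-encode v = refl

      initial-tvar : ∀ ℓ j i → initial (tvar ℓ j i) ≡ proj₂ (lookup ρ ℓ)
      initial-tvar ℓ j i = cong-value (inj₁ ((ℓ , j) , i))

      even-edge : ∀ d a j → parity initial (edge d a j) ≡ false
      even-edge d a j with a <? m | j <? M
      ... | yes _ | no _ = refl
      ... | no _  | _    = refl
      ... | yes p | yes q rewrite initial-tvar (line d (fromℕ< p)) (fromℕ< q) true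
                                | initial-tvar (line d (fromℕ< p)) (fromℕ< q) false
          = trans (cong (b xor_) (Boolₚ.xor-identityʳ b)) (Boolₚ.xor-same b)
        where b = proj₂ (lookup ρ (line d (fromℕ< p)))

      even-before : ∀ d a j → parity initial (before d a j) ≡ false
      even-before d a zero    = refl
      even-before d a (suc j) = even-edge d a j

    -- Flipping the edges between the positions u and u′ of a line moves the defect along it.
    module Move (d : Bool) (a u u′ : Fin m) where

      between : ℕ → Bool
      between j = (j <ᵇ toℕ u) xor (j <ᵇ toℕ u′)

      -- Of each edge on the path only the copy left free by `ρ` is flipped, so the restriction
      -- stays in force.
      flips : Variable → Bool
      flips (inj₁ ((ℓ , j) , i)) =
        does (ℓ Finₚ.≟ line d a) ∧ (does (i Boolₚ.≟ not (proj₁ (lookup ρ (line d a)))) ∧ between (toℕ j))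
      flips (inj₂ _) = false

      mask : Assignment V
      mask = flips ∘ decode

      mask-encode : ∀ v → mask (encode v) ≡ flips v
      mask-encode v = cong flips (decode-encode v)

      same : Bool → ℕ → Bool
      same d′ a′ = does (d′ Boolₚ.≟ d) ∧ (a′ ≡ᵇ toℕ a)

      same-line : ∀ d′ {a′} (a′<m : a′ < m) → does (line d′ (fromℕ< a′<m) Finₚ.≟ line d a) ≡ same d′ a′
      same-line d′ {a′} a′<m with line d′ (fromℕ< a′<m) Finₚ.≟ line d a | d′ Boolₚ.≟ d
      ... | yes e | no d′≢d = contradiction (proj₁ (line-injective {d′} {d} e)) d′≢d
      ... | yes e | yes _   = sym (trans (cong (_≡ᵇ toℕ a) a′≡a) (≡ᵇ-refl (toℕ a)))
        where
        a′≡a : a′ ≡ toℕ a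
        a′≡a = trans (sym (Finₚ.toℕ-fromℕ< a′<m)) (cong toℕ (proj₂ (line-injective {d′} {d} e)))
      ... | no _  | no _     = refl
      ... | no ne | yes refl = sym (≢⇒≡ᵇ λ a′≡a →
              ne (cong (line d) (Finₚ.toℕ-injective (trans (Finₚ.toℕ-fromℕ< a′<m) a′≡a))))

      mask-edge : ∀ d′ a′ j → parity mask (edge d′ a′ j) ≡ same d′ a′ ∧ between j
      mask-edge d′ a′ j with a′ <? m | j <? M
      ... | yes p | yes q
          rewrite mask-encode (inj₁ ((line d′ (fromℕ< p) , fromℕ< q) , true))
                | mask-encode (inj₁ ((line d′ (fromℕ< p) , fromℕ< q) , false))
                | Finₚ.toℕ-fromℕ< q | same-line d′ p = one-of-two (same d′ a′) (proj₁ (lookup ρ (line d a)))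
                    (between j)
        where
        one-of-two : ∀ s i b → (s ∧ (does (true Boolₚ.≟ not i) ∧ b)) xor
            ((s ∧ (does (false Boolₚ.≟ not i) ∧ b)) xor false) ≡ s ∧ b
        one-of-two false _     _ = refl
        one-of-two true  true  b = Boolₚ.xor-identityʳ b
        one-of-two true  false b = Boolₚ.xor-identityʳ b
      ... | yes p | no j≮M = sym (trans (cong (same d′ a′ ∧_) (cong₂ _xor_ (beyond u) (beyond u′)))
          (Boolₚ.∧-zeroʳ (same d′ a′)))
        where
        beyond : ∀ (v : Fin m) → (j <ᵇ toℕ v) ≡ false
        beyond v = ≮⇒<ᵇ λ j<v → j≮M (≤-trans j<v (≤-pred (Finₚ.toℕ<n v)))
      ... | no a′≮m | _ = sym (cong (_∧ between j) (trans (cong (does (d′ Boolₚ.≟ d) ∧_)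
              (≢⇒≡ᵇ {a′} {toℕ a} λ { refl → a′≮m (Finₚ.toℕ<n a) })) (Boolₚ.∧-zeroʳ _)))

      -- The successors account for position 0, which has no edge before it: both comparisons are
      -- then `true` and cancel.
      mask-before : ∀ d′ a′ p → parity mask (before d′ a′ p) ≡ same d′ a′ ∧
          ((p <ᵇ suc (toℕ u)) xor (p <ᵇ suc (toℕ u′)))
      mask-before d′ a′ zero    = sym (Boolₚ.∧-zeroʳ (same d′ a′))
      mask-before d′ a′ (suc j) = mask-edge d′ a′ j

      -- A cell inside the path meets two flipped edges, which cancel, and an end cell only one;
      -- `<ᵇ-suc` is this fact for each end separately.
      mask-line : ∀ d′ a′ p → parity mask (before d′ a′ p) xor parity mask (before d′ a′ (suc p)) ≡
                  same d′ a′ ∧ ((p ≡ᵇ toℕ u) xor (p ≡ᵇ toℕ u′))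
      mask-line d′ a′ p = begin
        parity mask (before d′ a′ p) xor parity mask (before d′ a′ (suc p))
          ≡⟨ cong₂ _xor_ (mask-before d′ a′ p) (mask-before d′ a′ (suc p)) ⟩
        (same d′ a′ ∧ (x xor x′)) xor (same d′ a′ ∧ (y xor y′))
          ≡⟨ solve 5 (λ s x x′ y y′ → (s :* (x :+ x′)) :+ (s :* (y :+ y′)) := s :*
              ((x :+ y) :+ (x′ :+ y′))) refl (same d′ a′) x x′ y y′ ⟩
        same d′ a′ ∧ ((x xor y) xor (x′ xor y′))
          ≡⟨ cong (same d′ a′ ∧_) (cong₂ _xor_ (<ᵇ-suc p (toℕ u)) (<ᵇ-suc p (toℕ u′))) ⟩
        same d′ a′ ∧ ((p ≡ᵇ toℕ u) xor (p ≡ᵇ toℕ u′)) ∎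
        where
        open ≡-Reasoning
        open xor-∧-Solver
        x  = p <ᵇ suc (toℕ u)
        x′ = p <ᵇ suc (toℕ u′)
        y  = p <ᵇ toℕ u
        y′ = p <ᵇ toℕ u′

      mask-untouched : ∀ {C} → Untouched (line d a) C → ∀ {x b} → (x , b) ∈ₗ C → mask x ≡ false
      mask-untouched {C} free {x} e with decode x in eq
      ... | inj₂ _ = refl
      ... | inj₁ ((ℓ , j) , i) with ℓ Finₚ.≟ line d a
      ...   | no _     = refl
      ...   | yes refl with () ← trans (sym (free j i))
          (trans (cong (lookup C) (trans (cong encode (sym eq)) (encode-decode x))) e)

      moved : Assignment V → Assignment V
      moved α x = α x xor mask x

      moved-agrees : ∀ {α C} → Untouched (line d a) C → ∀ {x b} → (x , b) ∈ₗ C → moved α x ≡ α x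
      moved-agrees {α} {C} free {x} e = trans (cong (α x xor_) (mask-untouched {C} free e))
          (Boolₚ.xor-identityʳ (α x))

      moved-unmasked : ∀ {α v b} → flips v ≡ false → α (encode v) ≡ b → moved α (encode v) ≡ b
      moved-unmasked {α} {v} unmasked e = trans (cong (α (encode v) xor_) (trans (mask-encode v) unmasked))
        (trans (Boolₚ.xor-identityʳ _) e)

      moved-critical : ∀ {r c r′ c′ α} →
        (∀ p q → at r c p q xor parity mask (cell p q) ≡ at r′ c′ p q) → Critical ρ r c α → Critical ρ r′ c′ (moved α)
      moved-critical {r} {c} {r′} {c′} {α} shift crit = record
        { restricted = λ ℓ j → moved-unmasked {α} {inj₁ ((ℓ , j) , proj₁ (lookup ρ ℓ))} (unflipped ℓ j)
            (restricted ℓ j)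
        ; y₀-true    = moved-unmasked {α} {inj₂ (inj₁ zero)} refl y₀-true
        ; y-false    = λ x∈ → case ∈-map⁻ yvar x∈ of λ { (i , _ , refl) →
            moved-unmasked {α} {inj₂ (inj₁ i)} refl (y-false x∈) }
        ; z-false    = λ x∈ → case ∈-map⁻ zvar x∈ of λ { (i , _ , refl) →
            moved-unmasked {α} {inj₂ (inj₂ i)} refl (z-false x∈) }
        ; one-defect = λ p q → begin
            parity (moved α) (cell p q)                           ≡⟨ parity-xor α mask (cell p q) ⟩
            parity α (cell p q) xor parity mask (cell p q)        ≡⟨ cong (_xor parity mask (cell p q))
                (one-defect p q) ⟩
            (charge p q xor at r c p q) xor parity mask (cell p q) ≡⟨ Boolₚ.xor-assoc (charge p q) (at r c p q) _ ⟩
            charge p q xor (at r c p q xor parity mask (cell p q)) ≡⟨ cong (charge p q xor_) (shift p q) ⟩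
            charge p q xor at r′ c′ p q                           ∎
        }
        where
        open Critical crit
        open ≡-Reasoning
        unflipped : ∀ ℓ j → flips (inj₁ ((ℓ , j) , proj₁ (lookup ρ ℓ))) ≡ false
        unflipped ℓ j with ℓ Finₚ.≟ line d a
        ... | no _ = refl
        ... | yes refl with proj₁ (lookup ρ (line d a))
        ...   | true  = refl
        ...   | false = refl

    row-shift : ∀ r c c′ p q → at r c p q xor parity (Move.mask true r c c′) (cell p q) ≡ at r c′ p q
    row-shift r c c′ p q = begin
      at r c p q xor parity mask (cell p q)
        ≡⟨ cong (at r c p q xor_) (trans (parity-cell mask p q)
            (cong₂ _xor_ (mask-line true p q) (mask-line false q p))) ⟩
      (R ∧ C) xor ((R ∧ (C xor C′)) xor false)
        ≡⟨ solve 3 (λ R C C′ → (R :* C) :+ ((R :* (C :+ C′)) :+ con false) := R :* C′) refl R C C′ ⟩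
      at r c′ p q ∎
      where
      open Move true r c c′
      open ≡-Reasoning
      open xor-∧-Solver
      R  = p ≡ᵇ toℕ r
      C  = q ≡ᵇ toℕ c
      C′ = q ≡ᵇ toℕ c′

    column-shift : ∀ r r′ c p q → at r c p q xor parity (Move.mask false c r r′) (cell p q) ≡ at r′ c p q
    column-shift r r′ c p q = begin
      at r c p q xor parity mask (cell p q)
        ≡⟨ cong (at r c p q xor_) (trans (parity-cell mask p q)
            (cong₂ _xor_ (mask-line true p q) (mask-line false q p))) ⟩
      (R ∧ C) xor (C ∧ (R xor R′))
        ≡⟨ solve 3 (λ R R′ C → (R :* C) :+ (C :* (R :+ R′)) := R′ :* C) refl R R′ C ⟩
      at r′ c p q ∎
      where
      open Move false c r r′
      open ≡-Reasoning
      open xor-∧-Solver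
      R  = p ≡ᵇ toℕ r
      R′ = p ≡ᵇ toℕ r′
      C  = q ≡ᵇ toℕ c

    record Relocated (x : Fin V) (C : Clause V) (α : Assignment V) : Set where
      field
        row column  : Fin m
        α′          : Assignment V
        critical    : Critical ρ row column α′
        row-free    : Untouched (line true row) C
        column-free : Untouched (line false column) C
        x∉row       : lineOf x ≢ just (line true row)
        x∉column    : lineOf x ≢ just (line false column)
        agrees      : ∀ {y b} → (y , b) ∈ₗ C → α′ y ≡ α y

    -- The variable `x` lies on at most one line. If this is the row of the defect, the defect moves
    -- along its column, which `C` does not touch, to another untouched row; the case of a column is
    -- symmetric. Nothing changes on the variables of `C`.
    relocate : ∀ x C {r c α} → touched C < M → Untouched (line true r) C → Untouched (line false c) C →
               Critical ρ r c α → Relocated x C α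
    relocate x C {r} {c} {α} few freeʳ freeᶜ crit
      with Maybeₚ.≡-dec Finₚ._≟_ (lineOf x) (just (line true r)) | Maybeₚ.≡-dec Finₚ._≟_ (lineOf x)
          (just (line false c))
    ... | no x∉r | no x∉c = record
      { row = r ; column = c ; α′ = α ; critical = crit ; row-free = freeʳ ; column-free = freeᶜ
      ; x∉row = x∉r ; x∉column = x∉c ; agrees = λ _ → refl }
    ... | yes x∈r | _ with r′ , r′≢r , freeʳ′ ← spare-line true r {C} few = record
      { row = r′ ; column = c ; α′ = Move.moved false c r r′ α
      ; critical = Move.moved-critical false c r r′ (column-shift r r′ c) crit
      ; row-free = freeʳ′ ; column-free = freeᶜ
      ; x∉row    = λ e → r′≢r (proj₂ (line-injective {true} {true} (just-injective (trans (sym e) x∈r))))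
      ; x∉column = λ e → case proj₁ (line-injective {false} {true} (just-injective (trans (sym e) x∈r))) of λ ()
      ; agrees   = Move.moved-agrees false c r r′ {α} {C} freeᶜ }
    ... | no x∉r | yes x∈c with c′ , c′≢c , freeᶜ′ ← spare-line false c {C} few = record
      { row = r ; column = c′ ; α′ = Move.moved true r c c′ α
      ; critical = Move.moved-critical true r c c′ (row-shift r c c′) crit
      ; row-free = freeʳ ; column-free = freeᶜ′
      ; x∉row    = x∉r
      ; x∉column = λ e → c′≢c (proj₂ (line-injective {false} {false} (just-injective (trans (sym e) x∈c))))
      ; agrees   = Move.moved-agrees true r c c′ {α} {C} freeʳ }

    -- The empty clause touches no line and is never satisfied, so it is not robust once a critical
    -- assignment exists.
    Robust : Clause V → Set
    Robust C = ∀ {r c α} → Untouched (line true r) C → Untouched (line false c) C → Critical ρ r c α → α ⊨ C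

    premise-free : ∀ {P R : Clause V} {x ℓ} → (∀ {y b} → y ≢ x → (y , b) ∈ₗ P → (y , b) ∈ₗ R) →
                   lineOf x ≢ just ℓ → Untouched ℓ R → Untouched ℓ P
    premise-free {P} {x = x} {ℓ} sub x∉ℓ free j i with lookup P (tvar ℓ j i) in eq
    ... | nothing = refl
    ... | just b with tvar ℓ j i Finₚ.≟ x
    ...   | yes refl = contradiction (lineOf-tvar ℓ j i) x∉ℓ
    ...   | no ne with () ← trans (sym (free j i)) (sub ne eq)

    -- A premise touches no line besides those of `R` and that of the pivot. With the defect moved
    -- off the pivot's line both premises are satisfied, hence `R` is, and the move does not affect
    -- the value of `R`.
    robust-narrow : ∀ {P P′ R} → touched R < M → Resolvent P P′ R → Robust P → Robust P′ → Robust R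
    robust-narrow {P} {P′} {R} few r robust robust′ freeʳ freeᶜ crit = back (resolvent-sound r {α′}
        (robust (premise-free {P} {R} subP x∉row row-free) (premise-free {P} {R} subP x∉column column-free) critical)
        (robust′ (premise-free {P′} {R} subP′ x∉row row-free)
            (premise-free {P′} {R} subP′ x∉column column-free) critical))
      where
      open Resolvent r
      open Relocated (relocate pivot R few freeʳ freeᶜ crit)
      subP : ∀ {y b} → y ≢ pivot → (y , b) ∈ₗ P → (y , b) ∈ₗ R
      subP {y} {b} y≢ e = union y b .from (y≢ , inj₁ e)
      subP′ : ∀ {y b} → y ≢ pivot → (y , b) ∈ₗ P′ → (y , b) ∈ₗ R
      subP′ {y} {b} y≢ e = union y b .from (y≢ , inj₂ e)
      back : α′ ⊨ R → _ ⊨ R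
      back (y , e) = literal⇒⊨ {C = R} e (sym (agrees e))

    robust-hit : ∀ {C ℓ} → lookup (profile C) ℓ ≡ just (lookup ρ ℓ) → Robust C
    robust-hit {C} {ℓ} hit _ _ crit with profile-just {C} {ℓ} hit
    ... | j , e = literal⇒⊨ {C = C} e (Critical.restricted crit ℓ j)

    edge-∋ : ∀ d (r : Fin m) {j} (j<M : j < M) → tvar (line d r) (fromℕ< j<M) true ∈ edge d (toℕ r) j
    edge-∋ d r {j} j<M with toℕ r <? m | j <? M
    ... | yes p | yes q = here (cong₂ (λ r j → tvar (line d r) j true) (sym (Finₚ.fromℕ<-toℕ r p))
        (Finₚ.fromℕ<-cong j j refl j<M q))
    ... | yes p | no j≮M = contradiction j<M j≮M
    ... | no r≮m | _     = contradiction (Finₚ.toℕ<n r) r≮m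

    -- In the first column the edge after the cell serves, elsewhere the edge before it.
    row-∋ : 1 ≤ M → ∀ (r c : Fin m) → ∃[ j ] tvar (line true r) j true ∈ cell (toℕ r) (toℕ c)
    row-∋ 1≤M r zero    = fromℕ< 1≤M , ∈-++⁺ˡ (edge-∋ true r 1≤M)
    row-∋ 1≤M r (suc c) = fromℕ< (Finₚ.toℕ<n c) ,
      ∈-++⁺ˡ (∈-++⁺ˡ (edge-∋ true r (Finₚ.toℕ<n c)))

    -- The axioms of the cell with the defect touch its row and are exempt. At every other cell the
    -- parity is right, so a critical assignment differs from the excluded one on some edge
    -- variable.
    axiom-robust : 1 ≤ M → ∀ {C} → C ∈ clauses formula → C ≡ Z ⊎ Robust C
    axiom-robust 1≤M C∈ with axiom⁻ C∈
    ... | is-W refl = inj₂ λ _ _ crit → literal⇒⊨ {C = W} (∈-blocking⁺ {β = const false} {y₀ ∷ ys} (here refl))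
        (Critical.y₀-true crit)
    ... | is-Z e    = inj₁ e
    ... | is-y x∈ refl = inj₂ λ _ _ crit → negUnit-⊨ (Critical.y-false crit x∈)
    ... | is-z x∈ refl = inj₂ λ _ _ crit → negUnit-⊨ (Critical.z-false crit x∈)
    ... | is-cell {p} {q} {β} _ _ bad refl = inj₂ robust
      where
      D = blocking β (y₀ ∷ cell p q)

      satisfied : ∀ {α} → parity α (cell p q) ≡ charge p q → α ⊨ D
      satisfied {α} even with parity-differ {α = α} {β} (cell p q) (λ e → contradiction
          (trans (sym (violates⇒odd {p} {q} {β} bad)) (trans (cong (_xor charge p q) (trans (sym e) even))
              (Boolₚ.xor-same (charge p q)))) λ ())
      ... | x , x∈ , ne = literal⇒⊨ {C = D} (∈-blocking⁺ {β = β} {y₀ ∷ cell p q} (there x∈)) (Boolₚ.¬-not ne)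

      elsewhere : ∀ {r c α} → Critical ρ r c α → at r c p q ≡ false → α ⊨ D
      elsewhere crit e = satisfied (trans (Critical.one-defect crit p q) (trans (cong (charge p q xor_) e) (Boolₚ.xor-identityʳ _)))

      robust : Robust D
      robust {r} {c} free _ crit with p ≟ toℕ r | q ≟ toℕ c
      ... | no p≢r | _     = elsewhere crit (cong (_∧ (q ≡ᵇ toℕ c)) (≢⇒≡ᵇ p≢r))
      ... | yes _ | no q≢c = elsewhere crit (trans (cong ((p ≡ᵇ toℕ r) ∧_) (≢⇒≡ᵇ q≢c)) (Boolₚ.∧-zeroʳ _))
      ... | yes refl | yes refl with j , x∈ ← row-∋ 1≤M r c
            with () ← trans (sym (free j true)) (∈-blocking⁺ {β = β} {y₀ ∷ cell p q} (there x∈))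

  Wide : Clause V → Set
  Wide C = M ≤ touched C

  -- Otherwise every derived clause but `Z` would be robust: the wide resolvents because `ρ` hits
  -- them, the narrow ones by moving the defect. But `𝟘` is not.
  wide-survivor : 1 ≤ M → (π : Refutation formula) → varSp π ≤ 2 * suc K → (ρ : Vec Option (m + m)) →
    ¬ (∀ {C} → C ∈ concat (configurations π) → Wide C → ∃[ ℓ ] lookup (profile C) ℓ ≡ just (lookup ρ ℓ))
  wide-survivor 1≤M π small ρ hit = case invariant Good I (axiom-robust ρ 1≤M) inference′ π good (λ ()) (here refl) of
    λ { (inj₁ e)      → 𝟘≢Z e
      ; (inj₂ robust) → 𝟘-unsatisfied (robust {zero} {zero} (untouched (line true zero))
                                              (untouched (line false zero)) (initial-critical ρ)) }
    where
    untouched : ∀ ℓ → Untouched ℓ 𝟘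
    untouched ℓ j i = lookup-replicate (tvar ℓ j i) nothing

    Hit : Clause V → Set
    Hit C = Wide C → ∃[ ℓ ] lookup (profile C) ℓ ≡ just (lookup ρ ℓ)

    Good : ClauseSet V → Set
    Good ℂ = totalWidth ℂ ≤ 2 * suc K × (∀ {C} → C ∈ ℂ → Hit C)

    I : Clause V → Set
    I C = C ≡ Z ⊎ Robust ρ C

    good : All Good (configurations π)
    good = All.tabulate λ ℂ∈ → ≤-trans (All.lookup (totalWidth-≤-varSp π) ℂ∈) small , λ C∈ → hit (∈-concat⁺′ C∈ ℂ∈)

    inference′ : ∀ {ℂ P P′ R} → Good ℂ → P ∈ ℂ → P′ ∈ ℂ → R ∈ ℂ → Resolvent P P′ R → I P → I P′ → I R
    inference′ {R = R} (tw , hits) P∈ P′∈ R∈ r iP iP′ with M ≤? touched R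
    ... | yes wide = inj₂ (robust-hit ρ {R} (proj₂ (hits R∈ wide)))
    ... | no narrow = inj₂ (robust-narrow ρ (≰⇒> narrow) r (rob iP (proj₁ ≢Z)) (rob iP′ (proj₂ ≢Z)))
      where
      ≢Z = wide-premise {W = Z} (posClause-positive zs)
             (≤-trans (s≤s tw) (≤-trans (*-monoʳ-< 2 (n<1+n (suc K)))
                 (*-monoʳ-≤ 2 (≤-reflexive (sym width-Z))))) P∈ P′∈ R∈ r
      rob : ∀ {C} → I C → C ≢ Z → Robust ρ C
      rob (inj₁ e) ≢Z = contradiction e ≢Z
      rob (inj₂ s) _  = s

  length-bound : 1 ≤ M → (π : Refutation formula) → varSp π ≤ 2 * suc K → 4 ^ M ≤ len π * 3 ^ M
  length-bound 1≤M π small with 4 ^ M ≤? len π * 3 ^ M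
  ... | yes h = h
  ... | no h  = ⊥-elim (wide-survivor 1≤M π small ρ hit)
    where
    derived wides : ClauseSet V
    derived = distinct (concat (configurations π))
    wides   = filter (λ C → M ≤? touched C) derived

    hitting-ρ : ∃[ ρ ] (∀ {v} → v ∈ map profile wides → ∃[ ℓ ] lookup v ℓ ≡ just (lookup ρ ℓ))
    hitting-ρ = hitting-wide M (map profile wides)
      (λ v∈ → case ∈-map⁻ profile v∈ of λ { (C , C∈ , refl) → proj₂
          (∈-filter⁻ (λ C → M ≤? touched C) {xs = derived} C∈) })
      (≤-trans (s≤s (*-monoˡ-≤ (3 ^ M) (≤-trans (≤-reflexive (length-map profile wides))
          (Listₚ.length-filter _ derived)))) (≰⇒> h))

    ρ = proj₁ hitting-ρ

    hit : ∀ {C} → C ∈ concat (configurations π) → Wide C → ∃[ ℓ ] lookup (profile C) ℓ ≡ just (lookup ρ ℓ)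
    hit C∈ wide = proj₂ hitting-ρ (∈-map⁺ profile (∈-filter⁺ (λ C → M ≤? touched C) (∈-deduplicate⁺ _≟ᶜ_ C∈) wide))

root : ℕ → ℕ
root zero    = zero
root (suc n) with suc (root n) * suc (root n) ≤? suc n
... | yes _ = suc (root n)
... | no _  = root n

root²≤ : ∀ n → root n * root n ≤ n
root²≤ zero    = z≤n
root²≤ (suc n) with suc (root n) * suc (root n) ≤? suc n
... | yes h = h
... | no _  = m≤n⇒m≤1+n (root²≤ n)

<root² : ∀ n → n < suc (root n) * suc (root n)
<root² zero    = s≤s z≤n
<root² (suc n) with suc (root n) * suc (root n) ≤? suc n
... | yes h = ≤-trans (s≤s (<root² n)) (*-mono-< (n<1+n (suc (root n))) (n<1+n (suc (root n))))
... | no h  = ≰⇒> h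

lines : ℕ → ℕ
lines n = suc (suc (root n))

area : ℕ → ℕ
area n = lines n * lines n

n≤area : ∀ n → n ≤ area n
n≤area n = ≤-trans (<⇒≤ (<root² n)) (*-mono-≤ (n≤1+n (suc (root n))) (n≤1+n (suc (root n))))

area≤9n : ∀ n → n ≥ 1 → area n ≤ 9 * n
area≤9n n n≥1 = begin
  area n                   ≡⟨ solve 1 (λ r → (con 2 :+ r) :* (con 2 :+ r) := con 4 :+ con 4 :* r :+ r :* r) refl r ⟩
  4 + 4 * r + r * r        ≤⟨ +-mono-≤ (+-mono-≤ (*-monoʳ-≤ 4 n≥1) (*-monoʳ-≤ 4 (≤-trans (r≤r*r r) (root²≤ n))))
      (root²≤ n) ⟩
  4 * n + 4 * n + n        ≡⟨ solve 1 (λ n → con 4 :* n :+ con 4 :* n :+ n := con 9 :* n) refl n ⟩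
  9 * n                    ∎
  where
  open ≤-Reasoning
  open +-*-Solver
  r = root n
  r≤r*r : ∀ r → r ≤ r * r
  r≤r*r zero    = z≤n
  r≤r*r (suc r) = m≤m*n (suc r) (suc r)

∈O-area : ∀ {f} c → (∀ n → f n ≤ c * area n) → f ∈O id
∈O-area {f} c h = c * 9 , 1 , λ n n≥1 →
  ≤-trans (h n) (≤-trans (*-monoʳ-≤ c (area≤9n n n≥1)) (≤-reflexive (sym (*-assoc c 9 n))))

∈Ω-area : ∀ {f} → (∀ n → area n ≤ f n) → f ∈Ω id
∈Ω-area {f} h = 1 , 0 , λ n _ → ≤-trans (n≤area n) (≤-trans (h n) (≤-reflexive (sym (*-identityˡ (f n)))))

cube : ℕ → ℕ
cube x = x * x * x

cube-mono : ∀ {x y} → x ≤ y → cube x ≤ cube y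
cube-mono h = *-mono-≤ (*-mono-≤ h h) h

cube-* : ∀ x y → cube (x * y) ≡ cube x * cube y
cube-* = solve 2 (λ x y → (x :* y) :* (x :* y) :* (x :* y) := (x :* x :* x) :* (y :* y :* y)) refl
  where open +-*-Solver

2^n*27^n≤64^n : ∀ n → 2 ^ n * cube (3 ^ n) ≤ cube (4 ^ n)
2^n*27^n≤64^n zero    = ≤-refl
2^n*27^n≤64^n (suc n) = begin
  2 * 2 ^ n * cube (3 * 3 ^ n)  ≡⟨ cong (2 * 2 ^ n *_) (cube-* 3 (3 ^ n)) ⟩
  2 * 2 ^ n * (27 * cube (3 ^ n))
    ≡⟨ solve 2 (λ x y → con 2 :* x :* (con 27 :* y) := con 54 :* (x :* y)) refl (2 ^ n) (cube (3 ^ n)) ⟩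
  54 * (2 ^ n * cube (3 ^ n))   ≤⟨ *-mono-≤ (m≤m+n 54 10) (2^n*27^n≤64^n n) ⟩
  64 * cube (4 ^ n)             ≡⟨ cube-* 4 (4 ^ n) ⟨
  cube (4 * 4 ^ n)              ∎
  where
  open ≤-Reasoning
  open +-*-Solver

exponential : ∀ n {l} → 4 ^ n ≤ l * 3 ^ n → 2 ^ n ≤ l ^ 3
exponential n {l} h = *-cancelʳ-≤ (2 ^ n) (l ^ 3) (cube (3 ^ n)) {{cube≢0}} (begin
  2 ^ n * cube (3 ^ n)   ≤⟨ 2^n*27^n≤64^n n ⟩
  cube (4 ^ n)           ≤⟨ cube-mono h ⟩
  cube (l * 3 ^ n)       ≡⟨ cube-* l (3 ^ n) ⟩
  cube l * cube (3 ^ n)  ≡⟨ cong (_* cube (3 ^ n)) (solve 1 (λ l → l :* l :* l := l :^ 3) refl l) ⟩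
  l ^ 3 * cube (3 ^ n)   ∎)
  where
  open ≤-Reasoning
  open +-*-Solver
  3^n≢0 = m^n≢0 3 n
  cube≢0 : NonZero (cube (3 ^ n))
  cube≢0 = m*n≢0 (3 ^ n * 3 ^ n) (3 ^ n) {{m*n≢0 (3 ^ n) (3 ^ n) {{3^n≢0}} {{3^n≢0}}}} {{3^n≢0}}

2^√≤ : ∀ {n l} → 2 ^ suc (root n) ≤ l ^ 3 → 2^[√ n / 3 ]≤ l
2^√≤ {n} {l} h p q p²≤ = begin
  2 ^ p                  ≤⟨ ^-monoʳ-≤ 2 p≤ ⟩
  2 ^ (r * q)            ≡⟨ ^-*-assoc 2 r q ⟨
  (2 ^ r) ^ q            ≤⟨ ^-monoˡ-≤ q h ⟩
  (l ^ 3) ^ q            ≡⟨ ^-*-assoc l 3 q ⟩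
  l ^ (3 * q)            ∎
  where
  open ≤-Reasoning
  open +-*-Solver
  r = suc (root n)
  p≤ : p ≤ r * q
  p≤ with p ≤? r * q
  ... | yes h = h
  ... | no p≰ = contradiction (*-mono-< (≰⇒> p≰) (≰⇒> p≰)) (≤⇒≯ (begin
    p * p                ≤⟨ p²≤ ⟩
    n * (q * q)          ≤⟨ *-monoˡ-≤ (q * q) (<⇒≤ (<root² n)) ⟩
    r * r * (q * q)      ≡⟨ solve 2 (λ r q → r :* r :* (q :* q) := r :* q :* (r :* q)) refl r q ⟩
    r * q * (r * q)      ∎))

blockSize : ℕ → ℕ
blockSize n = 77 * area n

formulas : ℕ → CNF
formulas n = Formula.formula (suc (root n)) (blockSize n)

space : ℕ → ℕ
space n = 2 * suc (blockSize n)

1≤area : ∀ n → 1 ≤ area n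
1≤area n = s≤s z≤n

affine≤ : ∀ a b n → a + b * area n ≤ (a + b) * area n
affine≤ a b n = begin
  a + b * area n           ≤⟨ +-monoˡ-≤ _ (≤-trans (≤-reflexive (sym (*-identityʳ a))) (*-monoʳ-≤ a (1≤area n))) ⟩
  a * area n + b * area n  ≡⟨ *-distribʳ-+ (area n) a b ⟨
  (a + b) * area n         ∎
  where open ≤-Reasoning

space≡ : ∀ n → space n ≡ 2 + 154 * area n
space≡ n = solve 1 (λ g → con 2 :* (con 1 :+ con 77 :* g) := con 2 :+ con 154 :* g) refl (area n)
  where open +-*-Solver

area≤blockSize : ∀ n → area n ≤ blockSize n
area≤blockSize n = m≤n*m (area n) 77

enough : ∀ n → 11 * lines n * (2 + 6 * (lines n + lines n)) ≤ space n
enough n = begin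
  11 * m * (2 + 6 * (m + m))  ≡⟨ solve 1 (λ m → con 11 :* m :*
      (con 2 :+ con 6 :* (m :+ m)) := con 22 :* m :+ con 132 :* (m :* m)) refl m ⟩
  22 * m + 132 * (m * m)      ≤⟨ +-monoˡ-≤ _ (*-monoʳ-≤ 22 (m≤m*n m m)) ⟩
  22 * (m * m) + 132 * (m * m) ≡⟨ *-distribʳ-+ (m * m) 22 132 ⟨
  154 * area n                ≤⟨ m≤n+m _ 2 ⟩
  2 + 154 * area n            ≡⟨ space≡ n ⟨
  space n                     ∎
  where
  open ≤-Reasoning
  open +-*-Solver
  m = lines n

module Family (n : ℕ) where
  open Refutations (suc (root n)) (blockSize n) public
  open LowerBound (suc (root n)) (blockSize n) public
  open Formula (suc (root n)) (blockSize n) public using (size-≥; size-≤)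

  minimal : IsMinVarSp (formulas n) (space n)
  minimal = let π , π≤ = small-refutation (enough n) in (π , ≤-antisym π≤ (space-bound π)) , space-bound

  unsatisfiable : Unsatisfiable (formulas n)
  unsatisfiable = refutation-unsat (proj₁ short-refutation)

  long : (π : Refutation (formulas n)) → varSp π ≡ space n → 2^[√ n / 3 ]≤ len π
  long π eq = 2^√≤ {n} (exponential (suc (root n)) {len π} (length-bound (s≤s z≤n) π (≤-reflexive eq)))

  size-linear : size (formulas n) ≤ (314 + cellCost) * area n
  size-linear = begin
    size (formulas n)                                               ≤⟨ size-≤ ⟩
    2 * (suc (blockSize n) + (2 + blockSize n)) + area n * cellCost
      ≡⟨ solve 2 (λ g c → con 2 :* ((con 1 :+ con 77 :* g) :+ (con 2 :+ con 77 :* g)) :+ g :* c := con 6 :+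
          (con 308 :+ c) :* g)
           refl (area n) cellCost ⟩
    6 + (308 + cellCost) * area n                                   ≤⟨ affine≤ 6 (308 + cellCost) n ⟩
    (314 + cellCost) * area n                                       ∎
    where
    open ≤-Reasoning
    open +-*-Solver

space+2≤ : ∀ n → space n + 2 ≤ 158 * area n
space+2≤ n = ≤-trans (≤-reflexive (trans (+-comm (space n) 2) (cong (2 +_) (space≡ n)))) (affine≤ 4 154 n)

area≤space : ∀ n → area n ≤ space n
area≤space n = ≤-trans (area≤blockSize n) (≤-trans (n≤1+n (blockSize n)) (m≤n*m (suc (blockSize n)) 2))

shortLength : ℕ → ℕ
shortLength n = suc (2 * (2 + blockSize n))

shortLength≤ : ∀ n → shortLength n ≤ 159 * area n
shortLength≤ n = ≤-trans (≤-reflexive (solve 1 (λ g → con 1 :+ con 2 :*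
    (con 2 :+ con 77 :* g) := con 5 :+ con 154 :* g) refl (area n)))
  (affine≤ 5 154 n)
  where open +-*-Solver

theorem2p4 : Σ[ F ∈ (ℕ → CNF) ] Σ[ s ∈ (ℕ → ℕ) ]
    ( (∀ n → n ≥ 1 → Unsatisfiable (F n))
    × (size ∘ F) ∈Θ id
    × (∀ n → n ≥ 1 → IsMinVarSp (F n) (s n))
    × s ∈Θ id
    × (∃[ c ] ∃[ n₀ ] (∀ n → n ≥ n₀ → n ≥ 1 → (π : Refutation (F n)) → varSp π ≡ s n → 2^[√ n / c ]≤ len π))
    × (λ n → s n + 2) ∈Θ id
    × (Σ[ ℓ ∈ (ℕ → ℕ) ] (ℓ ∈O id × (∀ n → n ≥ 1 → Σ[ π′ ∈ Refutation (F n) ] (varSp π′ ≤ s n + 2 × len π′ ≤ ℓ n)))) )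
theorem2p4 =
  formulas , space ,
  (λ n _ → Family.unsatisfiable n) ,
  (∈O-area (314 + cellCost) Family.size-linear ,
   ∈Ω-area (λ n → ≤-trans (area≤blockSize n) (≤-trans (n≤1+n (blockSize n)) (Family.size-≥ n)))) ,
  (λ n _ → Family.minimal n) ,
  (∈O-area 158 (λ n → ≤-trans (m≤m+n (space n) 2) (space+2≤ n)) , ∈Ω-area area≤space) ,
  (3 , 0 , λ n _ _ → Family.long n) ,
  (∈O-area 158 space+2≤ , ∈Ω-area (λ n → ≤-trans (area≤space n) (m≤m+n (space n) 2))) ,
  shortLength , ∈O-area 159 shortLength≤ , λ n _ →
    let π , π≤ , len≤ = Family.short-refutation n
    in π , ≤-trans π≤ (≤-reflexive (trans (*-suc 2 (suc (blockSize n))) (+-comm 2 (space n)))) , len≤
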